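{- Let $f(N)$ denote the largest size of a set $A\subseteq[N]=\{1,\dots,N\}$ with distinct subset products. Then $$f(N)=\pi(N)+\pi(N^{1/2})+O(N^{5/12+o(1)}),$$ i.e. for every $\varepsilon>0$ there is a constant $C_\varepsilon$ such that $|f(N)-\pi(N)-\pi(N^{1/2})|\le C_\varepsilon N^{5/12+\varepsilon}$ for all $N\in\mathbb{N}$.
   Context: A finite set $A\subset\mathbb{N}$ has distinct subset products if for any two distinct subsets $B,C\subseteq A$ we have $\prod_{b\in B}b\neq\prod_{c\in C}c$. $\pi(x)$ denotes the number of primes $\le x$. -}

module Defs where

open import Data.Nat.Base using (ℕ; suc; _*_; _≤_)
open import Data.Nat.Properties using (_≤?_)
open import Data.Nat.ListAction using (product)
open import Data.Fin.Base using (Fin; toℕ)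
open import Data.Fin.Subset using (Subset; _⊆_; ∣_∣)
open import Data.Fin.Subset.Properties using (_∈?_)
open import Data.List.Base using (List; length; filter; map; upTo; allFin)
open import Data.Nat.Primality using (prime?)
open import Data.Product.Base using (_×_; ∃)
open import Relation.Nullary.Decidable using (_×-dec_)
open import Relation.Binary.PropositionalEquality using (_≡_)

-- A subset of [N] = {1,…,N} is represented as a Subset N (Vec Bool N),
-- where the index i : Fin N stands for the natural number toℕ i + 1.

subsetProduct : ∀ {N} → Subset N → ℕ
subsetProduct {N} B = product (map (λ i → suc (toℕ i)) (filter (_∈? B) (allFin N)))

DistinctSubsetProducts : ∀ {N} → Subset N → Set
DistinctSubsetProducts A =
  ∀ B C → B ⊆ A → C ⊆ A → subsetProduct B ≡ subsetProduct C → B ≡ C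

IsLargestDSPSize : ℕ → ℕ → Set
IsLargestDSPSize N m =
  (∃ λ (A : Subset N) → DistinctSubsetProducts A × ∣ A ∣ ≡ m)
  × (∀ (A : Subset N) → DistinctSubsetProducts A → ∣ A ∣ ≤ m)

primeCount : ℕ → ℕ
primeCount x = length (filter prime? (upTo (suc x)))

primeCountSqrt : ℕ → ℕ
primeCountSqrt N = length (filter (λ p → prime? p ×-dec (p * p ≤? N)) (upTo (suc N)))

{-# OPTIONS --safe #-}
module Submission where

-- Lower bound: the primes p ≤ N together with the squares p² ≤ N; the exponent of p in a subset
-- product is a + 2 b with binary digits a and b.
--
-- Upper bound: let Z¹² be just above N.  Every n ≤ N is n = x y s with x equal to 1 or a prime up to
-- √N, y equal to 1 or a prime up to N, and s a product of numbers ≤ Z⁴, because n has at most two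
-- prime factors above Z⁴.  Read A as the edge set of a bipartite graph in which n joins x to y.
-- Around a cycle the alternate edges have the same product of the x y.  If j edge-disjoint cycles
-- exist, choosing one half of each gives 2 ^ j subsets of A whose products differ only in the s part,
-- so j = O (Z⁴ log N) by pigeonhole.  On the other hand, as long as the number of edges exceeds the
-- number of vertices by √N / Z, some ball of radius O (Z log N) contains a cycle: a ball without one
-- is a tree, and either its side among the x grows by the factor 1 + 1 / Z, or it can be cut off at
-- a cost of 1 / Z per vertex x.  Removing short cycles greedily bounds the excess of edges over
-- vertices by O (√N / Z + Z⁴ log N · Z log N) = O (N ^ (5/12) (log N)²).

open import Defs
open import Algebra.Properties.CommutativeSemigroup using (x∙yz≈y∙xz)
open import Data.Bool.Base using (Bool; true; false)
open import Data.Empty using (⊥-elim)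
open import Data.Fin.Base using (Fin; zero; suc; toℕ; fromℕ<; funToFin; finToFun; remQuot; combine)
import Data.Fin.Properties as Fin
open import Data.Fin.Subset using (Subset; ∣_∣) renaming (_∈_ to _∈ₛ_; _⊆_ to _⊆ₛ_)
open import Data.Fin.Subset.Properties using (drop-there; ⊆-antisym; ∣p∣≤n)
  renaming (_∈?_ to _∈ₛ?_)
open import Data.List.Base
  using (List; []; _∷_; _++_; length; filter; map; concatMap; allFin; upTo; tabulate)
open import Data.List.Properties
  using (map-++; length-++; length-map; length-filter; length-upTo; length-tabulate;
         filter-accept; filter-reject; filter-++; filter-none)
import Data.List.Membership.DecPropositional as DecMembership
open import Data.List.Membership.Propositional using (_∈_; _∉_)
open import Data.List.Membership.Propositional.Properties
  using (∈-∃++; ∈-++⁺ˡ; ∈-++⁺ʳ; ∈-++⁻; ∈-map⁺; ∈-map⁻; ∈-filter⁺; ∈-filter⁻; ∈-length;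
         ∈-allFin; ∈-upTo⁺; ∈-upTo⁻)
open import Data.List.Membership.Propositional.Properties.WithK using (unique∧set⇒bag)
open import Data.List.Relation.Binary.BagAndSetEquality using (∼bag⇒↭)
open import Data.List.Relation.Binary.Permutation.Propositional
  using (_↭_; prep; ↭-refl; ↭-sym; ↭-trans)
import Data.List.Relation.Binary.Permutation.Propositional.Properties as ↭
open import Data.List.Relation.Binary.Subset.Propositional using (_⊆_)
open import Data.List.Relation.Unary.All as All using (All; []; _∷_)
import Data.List.Relation.Unary.All.Properties as All
open import Data.List.Relation.Unary.AllPairs using ([]; _∷_)
open import Data.List.Relation.Unary.Any using (here; there)
open import Data.List.Relation.Unary.Unique.Propositional using (Unique)
open import Data.List.Relation.Unary.Unique.Propositional.Properties as Unique
  using (Unique[x∷xs]⇒x∉xs)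
open import Data.Nat.Base
open import Data.Nat.Divisibility using (divides)
open import Data.Nat.DivMod using (_/_; _%_; m≡m%n+[m/n]*n; m%n<n; m/n*n≤m)
open import Data.Nat.ListAction using (product)
open import Data.Nat.ListAction.Properties using (product-++; product-↭)
open import Data.Nat.Primality
  using (Prime; prime?; prime⇒nonTrivial; prime⇒nonZero; prime⇒irreducible; productOfPrimes≥1;
         ¬prime[0]; ¬prime[1])
open import Data.Nat.Primality.Factorisation
  using (PrimeFactorisation; factorise; factorisationUnique; primeFactorisation[1])
open import Data.Nat.Properties
open import Data.Nat.Tactic.RingSolver using (solve-∀)
open import Data.Product.Base using (∃; ∃-syntax; _×_; _,_; proj₁; proj₂; uncurry)
open import Data.Sum.Base using (_⊎_; inj₁; inj₂; [_,_]′; map₂)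
open import Data.Vec.Base as Vec using (Vec; []; _∷_)
open import Data.Vec.Properties using (lookup∘tabulate; []=⇒lookup; lookup⇒[]=; ∷-injective)
open import Function.Base using (_∘_; id; case_of_)
open import Function.Bundles using (mk⇔; Inverse; Injection)
open import Function.Properties.Inverse using (Inverse⇒Injection)
open import Relation.Binary.Definitions using (DecidableEquality; tri<; tri≈; tri>)
open import Relation.Binary.PropositionalEquality
open import Relation.Nullary using (yes; no; ¬_; contradiction; does)
open import Relation.Nullary.Decidable using (¬?; _×-dec_; dec-true)
open import Relation.Unary using (Decidable)

open DecMembership _≟_ using () renaming (_∈?_ to _∈ℕ?_)


-- Counting in duplicate-free lists

Unique-∷ : ∀ {A : Set} {x : A} {xs} → x ∉ xs → Unique xs → Unique (x ∷ xs)
Unique-∷ x∉xs xs! = All.¬Any⇒All¬ _ x∉xs ∷ xs!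

Unique-⊆⇒length-≤ : ∀ {A : Set} {xs ys : List A} → Unique xs → xs ⊆ ys → length xs ≤ length ys
Unique-⊆⇒length-≤ {xs = []} _ _ = z≤n
Unique-⊆⇒length-≤ {xs = x ∷ xs} xxs!@(_ ∷ xs!) x∷xs⊆ys
  with as , bs , refl ← ∈-∃++ (x∷xs⊆ys (here refl)) = begin
    suc (length xs)               ≤⟨ s≤s (Unique-⊆⇒length-≤ xs! xs⊆as++bs) ⟩
    suc (length (as ++ bs))       ≡⟨ cong suc (length-++ as) ⟩
    suc (length as + length bs)   ≡⟨ +-suc (length as) (length bs) ⟨
    length as + suc (length bs)   ≡⟨ length-++ as ⟨
    length (as ++ x ∷ bs)         ∎
  where
  open ≤-Reasoning
  xs⊆as++bs : xs ⊆ as ++ bs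
  xs⊆as++bs z∈xs with ∈-++⁻ as (x∷xs⊆ys (there z∈xs))
  ... | inj₁ z∈as = ∈-++⁺ˡ z∈as
  ... | inj₂ (here refl) = contradiction z∈xs (Unique[x∷xs]⇒x∉xs xxs!)
  ... | inj₂ (there z∈bs) = ∈-++⁺ʳ as z∈bs

length-filter-¬ : ∀ {A : Set} {P : A → Set} (P? : Decidable P) xs →
                  length (filter P? xs) + length (filter (¬? ∘ P?) xs) ≡ length xs
length-filter-¬ P? [] = refl
length-filter-¬ P? (x ∷ xs) with P? x
... | yes _ = cong suc (length-filter-¬ P? xs)
... | no _  = trans (+-suc _ _) (cong suc (length-filter-¬ P? xs))

length-filter-∉ : ∀ {xs ys} → Unique xs → xs ⊆ ys →
                  length xs + length (filter (λ z → ¬? (z ∈ℕ? xs)) ys) ≤ length ys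
length-filter-∉ {xs} {ys} xs! xs⊆ys = begin
  length xs + length (filter (λ z → ¬? (z ∈ℕ? xs)) ys)
    ≤⟨ +-monoˡ-≤ _ (Unique-⊆⇒length-≤ xs! (λ z∈xs → ∈-filter⁺ (_∈ℕ? xs) (xs⊆ys z∈xs) z∈xs)) ⟩
  length (filter (_∈ℕ? xs) ys) + length (filter (λ z → ¬? (z ∈ℕ? xs)) ys)
    ≡⟨ length-filter-¬ (_∈ℕ? xs) ys ⟩
  length ys ∎
  where open ≤-Reasoning

m+1+n≡o⇒1+m≤o : ∀ m {n o} → m + suc n ≡ o → suc m ≤ o
m+1+n≡o⇒1+m≤o m {n} refl = ≤-trans (m≤m+n (suc m) n) (≤-reflexive (sym (+-suc m n)))

-- Exchanges, walks and trees in a bipartite graph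

module _ {E : Set} (_≟E_ : DecidableEquality E) (w : E → ℕ) where

  open DecMembership _≟E_ using () renaming (_∈?_ to _∈E?_)

  weight : List E → ℕ
  weight es = product (map w es)

  weight-++ : ∀ es fs → weight (es ++ fs) ≡ weight es * weight fs
  weight-++ es fs = trans (cong product (map-++ w es fs)) (product-++ (map w es) (map w fs))

  -- The two halves of a cycle. They may overlap, because the walks that close the cycle can share
  -- their first edges; a shared edge then lies in both `B` and `C`. The edge `witness` still
  -- separates them as sets.
  record Exchange (es : List E) (ℓ : ℕ) : Set where
    field
      B C      : List E
      B⊆       : B ⊆ es
      C⊆       : C ⊆ es
      B!       : Unique B
      C!       : Unique C
      balanced : weight B ≡ weight C
      witness  : E
      witness∈ : witness ∈ B
      witness∉ : witness ∉ C
      short    : length B + length C ≤ ℓ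

  Exchange-mono : ∀ {es ℓ ℓ′} → ℓ ≤ ℓ′ → Exchange es ℓ → Exchange es ℓ′
  Exchange-mono ℓ≤ c = record { Exchange c ; short = ≤-trans (Exchange.short c) ℓ≤ }

  Exchange-⊆ : ∀ {es fs ℓ} → es ⊆ fs → Exchange es ℓ → Exchange fs ℓ
  Exchange-⊆ es⊆ c = record
    { Exchange c ; B⊆ = es⊆ ∘ Exchange.B⊆ c ; C⊆ = es⊆ ∘ Exchange.C⊆ c }

  -- A walk from the root to the vertex v.  The edges of a tree alternate between the classes U and
  -- D according to the side on which their far end lies; the constants a and b record the root.
  record Path (U D : List E) (a b v h : ℕ) : Set where
    field
      P Q   : List E
      P⊆    : P ⊆ U
      Q⊆    : Q ⊆ D
      P!    : Unique P
      Q!    : Unique Q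
      joins : b * weight P ≡ v * (a * weight Q)
      short : length P + length Q ≤ h

  open Path

  Path-mono : ∀ {U U′ D D′ a b v h h′} → U ⊆ U′ → D ⊆ D′ → h ≤ h′ →
              Path U D a b v h → Path U′ D′ a b v h′
  Path-mono U⊆ D⊆ h≤ p = record
    { P = P p ; Q = Q p ; P⊆ = U⊆ ∘ P⊆ p ; Q⊆ = D⊆ ∘ Q⊆ p ; P! = P! p ; Q! = Q! p
    ; joins = joins p ; short = ≤-trans (short p) h≤ }

  -- Products of alternate edges telescope along a walk: multiplying by `w e` trades the end `v` for
  -- `v′`. Each step exchanges the two alternating halves, hence the swaps of `U` with `D` and of
  -- `a` with `b`.
  extendPath : ∀ {U D a b v v′ h e} → w e ≡ v * v′ → e ∉ D → Path U D a b v h →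
               Path (e ∷ D) U b a v′ (suc h)
  extendPath {a = a} {b} {v} {v′} {h} {e} we e∉D p = record
    { P = e ∷ Q p
    ; Q = P p
    ; P⊆ = λ { (here refl) → here refl ; (there q) → there (Q⊆ p q) }
    ; Q⊆ = P⊆ p
    ; P! = Unique-∷ (e∉D ∘ Q⊆ p) (Q! p)
    ; Q! = P! p
    ; joins = begin
        a * (w e * weight (Q p))       ≡⟨ cong (λ z → a * (z * weight (Q p))) we ⟩
        a * (v * v′ * weight (Q p))    ≡⟨ rearrange a v v′ (weight (Q p)) ⟩
        v′ * (v * (a * weight (Q p)))  ≡⟨ cong (v′ *_) (joins p) ⟨
        v′ * (b * weight (P p))        ∎
    ; short = s≤s (≤-trans (≤-reflexive (+-comm (length (Q p)) _)) (short p)) }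
    where
    open ≡-Reasoning
    rearrange : ∀ a v v′ q → a * (v * v′ * q) ≡ v′ * (v * (a * q))
    rearrange = solve-∀

  -- An edge outside the tree between two tree vertices closes a cycle. One half is `e` with both
  -- lists `Q`, the other is both lists `P`; the relations `joins` make the weights equal after
  -- cancelling `a * b`. Within each half the two walks contribute edges from different classes, so
  -- no edge repeats even when the walks overlap.
  closePaths : ∀ {es U D a b v v′ h h′ e} .{{_ : NonZero a}} .{{_ : NonZero b}} → w e ≡ v * v′ →
               U ⊆ es → D ⊆ es → (∀ {f} → f ∈ U → f ∉ D) → e ∈ es → e ∉ U → e ∉ D →
               Path U D a b v h → Path D U b a v′ h′ → Exchange es (suc (h + h′))
  closePaths {es} {U} {D} {a} {b} {v} {v′} {h} {h′} {e} we U⊆ D⊆ U∩D e∈es e∉U e∉D p q = record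
    { B = e ∷ Q p ++ Q q
    ; C = P p ++ P q
    ; B⊆ = λ { (here refl) → e∈es
             ; (there z) → [ D⊆ ∘ Q⊆ p , U⊆ ∘ Q⊆ q ]′ (∈-++⁻ (Q p) z) }
    ; C⊆ = λ z → [ U⊆ ∘ P⊆ p , D⊆ ∘ P⊆ q ]′ (∈-++⁻ (P p) z)
    ; B! = Unique-∷ (λ z → [ e∉D ∘ Q⊆ p , e∉U ∘ Q⊆ q ]′ (∈-++⁻ (Q p) z))
                    (Unique.++⁺ (Q! p) (Q! q) (λ { (z , z′) → U∩D (Q⊆ q z′) (Q⊆ p z) }))
    ; C! = Unique.++⁺ (P! p) (P! q) (λ { (z , z′) → U∩D (P⊆ p z) (P⊆ q z′) })
    ; balanced = *-cancelˡ-≡ _ _ (a * b) {{m*n≢0 a b}} (begin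
        a * b * (w e * weight (Q p ++ Q q))
          ≡⟨ cong₂ (λ s t → a * b * (s * t)) we (weight-++ (Q p) (Q q)) ⟩
        a * b * (v * v′ * (weight (Q p) * weight (Q q)))
          ≡⟨ rearrange a b v v′ (weight (Q p)) (weight (Q q)) ⟩
        v * (a * weight (Q p)) * (v′ * (b * weight (Q q)))
          ≡⟨ cong₂ _*_ (joins p) (joins q) ⟨
        b * weight (P p) * (a * weight (P q))
          ≡⟨ rearrange′ a b (weight (P p)) (weight (P q)) ⟩
        a * b * (weight (P p) * weight (P q))
          ≡⟨ cong (a * b *_) (weight-++ (P p) (P q)) ⟨
        a * b * weight (P p ++ P q) ∎)
    ; witness = e
    ; witness∈ = here refl
    ; witness∉ = λ z → [ e∉U ∘ P⊆ p , e∉D ∘ P⊆ q ]′ (∈-++⁻ (P p) z)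
    ; short = s≤s (≤-trans (≤-reflexive lengths) (+-mono-≤ (short p) (short q))) }
    where
    open ≡-Reasoning
    rearrange : ∀ a b v v′ s t → a * b * (v * v′ * (s * t)) ≡ v * (a * s) * (v′ * (b * t))
    rearrange = solve-∀
    rearrange′ : ∀ a b s t → b * s * (a * t) ≡ a * b * (s * t)
    rearrange′ = solve-∀
    regroup : ∀ k l m n → k + l + (m + n) ≡ m + k + (n + l)
    regroup = solve-∀
    lengths : length (Q p ++ Q q) + length (P p ++ P q) ≡
              length (P p) + length (Q p) + (length (P q) + length (Q q))
    lengths = trans (cong₂ _+_ (length-++ (Q p)) (length-++ (P p)))
                    (regroup (length (Q p)) (length (Q q)) (length (P p)) (length (P q)))

  -- A tree with edge classes U, D in the bipartite graph with edges es, where e joins x e to y e.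
  record Tree (es : List E) (x y : E → ℕ) (XV YV : List ℕ) (U D : List E) (X Y : List ℕ)
              (a b h h′ : ℕ) : Set where
    field
      U⊆    : U ⊆ es
      D⊆    : D ⊆ es
      U∩D   : ∀ {e} → e ∈ U → e ∉ D
      X!    : Unique X
      Y!    : Unique Y
      X⊆    : X ⊆ XV
      Y⊆    : Y ⊆ YV
      size  : suc (length U + length D) ≡ length X + length Y
      ends  : ∀ {e} → e ∈ U ⊎ e ∈ D → x e ∈ X × y e ∈ Y
      pathX : ∀ {v} → v ∈ X → Path U D a b v h
      pathY : ∀ {v} → v ∈ Y → Path D U b a v h′

  -- A sweep adds vertices on one side only; flipping the tree lets the same sweep serve the other
  -- side. Relaxing `h` to `k` restores the shape `h`, `suc h` of the depth bounds.
  Tree-flip : ∀ {es x y XV YV U D X Y a b h h′ k} → h ≤ k →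
              Tree es x y XV YV U D X Y a b h h′ → Tree es y x YV XV D U Y X b a h′ k
  Tree-flip {U = U} {D} {X} {Y} h≤k t = record
    { U⊆ = D⊆ ; D⊆ = U⊆ ; U∩D = λ d u → U∩D u d ; X! = Y! ; Y! = X! ; X⊆ = Y⊆ ; Y⊆ = X⊆
    ; size = trans (cong suc (+-comm (length D) (length U))) (trans size (+-comm (length X) _))
    ; ends = λ { (inj₁ d) → let p , q = ends (inj₂ d) in q , p
               ; (inj₂ u) → let p , q = ends (inj₁ u) in q , p }
    ; pathX = pathY
    ; pathY = Path-mono id id h≤k ∘ pathX }
    where open Tree t

  growTree : ∀ {es x y XV YV U D X Y a b h e} → w e ≡ x e * y e → e ∈ es → e ∉ U → e ∉ D →
             x e ∈ X → y e ∈ YV → y e ∉ Y → Tree es x y XV YV U D X Y a b h (suc h) →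
             Tree es x y XV YV U (e ∷ D) X (y e ∷ Y) a b h (suc h)
  growTree {es} {x} {y} {U = U} {D} {X} {Y} {e = e} we e∈es e∉U e∉D xe∈X ye∈YV ye∉Y t = record
    { U⊆ = U⊆
    ; D⊆ = λ { (here refl) → e∈es ; (there d) → D⊆ d }
    ; U∩D = λ { u (here refl) → e∉U u ; u (there d) → U∩D u d }
    ; X! = X!
    ; Y! = Unique-∷ ye∉Y Y!
    ; X⊆ = X⊆
    ; Y⊆ = λ { (here refl) → ye∈YV ; (there z) → Y⊆ z }
    ; size = trans (cong suc (+-suc (length U) (length D)))
                   (trans (cong suc size) (sym (+-suc (length X) (length Y))))
    ; ends = λ { (inj₁ u) → let p , q = ends (inj₁ u) in p , there q
               ; (inj₂ (here refl)) → xe∈X , here refl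
               ; (inj₂ (there d)) → let p , q = ends (inj₂ d) in p , there q }
    ; pathX = Path-mono id there ≤-refl ∘ pathX
    ; pathY = λ { (here refl) → extendPath {v = x e} we e∉D (pathX xe∈X)
                ; (there z) → Path-mono there id ≤-refl (pathY z) } }
    where open Tree t

  -- One layer of the search: `X` and `U` stay fixed, while new neighbours of `X` enter `Y′` through
  -- edges in `D′`.
  record Sweep (es : List E) (x y : E → ℕ) (XV YV : List ℕ) (U D : List E) (X Y : List ℕ)
               (a b h : ℕ) (todo : List E) : Set where
    field
      D′   : List E
      Y′   : List ℕ
      D⊆D′ : D ⊆ D′
      Y⊆Y′ : Y ⊆ Y′
      tree : Tree es x y XV YV U D′ X Y′ a b h (suc h)
      done : ∀ {e} → e ∈ todo → x e ∈ X → e ∈ U ⊎ e ∈ D′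

  Sweep-∷ : ∀ {es x y XV YV U D X Y a b h todo e} →
            (∀ {D′} → D ⊆ D′ → x e ∈ X → e ∈ U ⊎ e ∈ D′) →
            Sweep es x y XV YV U D X Y a b h todo → Sweep es x y XV YV U D X Y a b h (e ∷ todo)
  Sweep-∷ e-done s = record
    { Sweep s
    ; done = λ { (here refl) → e-done (Sweep.D⊆D′ s) ; (there z) → Sweep.done s z } }

  Sweep-⊆ : ∀ {es x y XV YV U D D₁ X Y Y₁ a b h todo} → D ⊆ D₁ → Y ⊆ Y₁ →
            Sweep es x y XV YV U D₁ X Y₁ a b h todo → Sweep es x y XV YV U D X Y a b h todo
  Sweep-⊆ D⊆D₁ Y⊆Y₁ s = record
    { D′ = D′ ; Y′ = Y′ ; D⊆D′ = D⊆D′ ∘ D⊆D₁ ; Y⊆Y′ = Y⊆Y′ ∘ Y⊆Y₁ ; tree = tree ; done = done }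
    where open Sweep s

  -- An edge at `X` outside the tree either has a new far end, and is attached as a leaf, or joins
  -- two tree vertices, and closes an exchange of length at most `suc (h + suc h)`.
  sweep : ∀ {es x y XV YV U D X Y a b h ℓ} .{{_ : NonZero a}} .{{_ : NonZero b}} →
          (∀ e → w e ≡ x e * y e) → (∀ {e} → e ∈ es → y e ∈ YV) → suc (h + suc h) ≤ ℓ →
          ∀ todo → todo ⊆ es → Tree es x y XV YV U D X Y a b h (suc h) →
          Exchange es ℓ ⊎ Sweep es x y XV YV U D X Y a b h todo
  sweep {D = D} {Y = Y} _ _ _ [] _ t = inj₂ record
    { D′ = D ; Y′ = Y ; D⊆D′ = id ; Y⊆Y′ = id ; tree = t ; done = λ () }
  sweep {es} {x} {y} {XV} {YV} {U} {D} {X} {Y} {a} {b} {h} we yV ℓ≥ (e ∷ todo) todo⊆ t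
    with e ∈E? U | e ∈E? D | x e ∈ℕ? X | y e ∈ℕ? Y
  ... | yes e∈U | _ | _ | _ =
    map₂ (Sweep-∷ λ _ _ → inj₁ e∈U) (sweep we yV ℓ≥ todo (todo⊆ ∘ there) t)
  ... | no _ | yes e∈D | _ | _ =
    map₂ (Sweep-∷ λ D⊆D′ _ → inj₂ (D⊆D′ e∈D)) (sweep we yV ℓ≥ todo (todo⊆ ∘ there) t)
  ... | no _ | no _ | no xe∉X | _ =
    map₂ (Sweep-∷ λ _ xe∈X → contradiction xe∈X xe∉X) (sweep we yV ℓ≥ todo (todo⊆ ∘ there) t)
  ... | no e∉U | no e∉D | yes xe∈X | yes ye∈Y = inj₁ (Exchange-mono ℓ≥
    (closePaths {v = x e} {y e} (we e) U⊆ D⊆ U∩D (todo⊆ (here refl)) e∉U e∉D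
                (pathX xe∈X) (pathY ye∈Y)))
    where open Tree t
  ... | no e∉U | no e∉D | yes xe∈X | no ye∉Y =
    map₂ (λ s → Sweep-⊆ there there (Sweep-∷ (λ D⊆D′ _ → inj₂ (D⊆D′ (here refl))) s))
         (sweep we yV ℓ≥ todo (todo⊆ ∘ there)
                (growTree (we e) e∈es e∉U e∉D xe∈X (yV e∈es) ye∉Y t))
    where
    e∈es : e ∈ es
    e∈es = todo⊆ (here refl)

  -- Growing balls and cutting them off

  -- By `closed`, deleting the edges that meet `Y` leaves no edge at `X` either, so `X` and `Y` can
  -- both be struck from the vertex lists. Divided by `d`, `few` charges the deleted edges to these
  -- vertices, 1 per vertex of `Y` and 1 + 1/d per vertex of `X`.
  record Ball (es : List E) (x y : E → ℕ) (XV YV : List ℕ) (d ρ : ℕ) : Set where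
    field
      X Y    : List ℕ
      X!     : Unique X
      Y!     : Unique Y
      X⊆     : X ⊆ XV
      Y⊆     : Y ⊆ YV
      root   : ρ ∈ X
      closed : ∀ {e} → e ∈ es → x e ∈ X → y e ∈ Y
      few    : d * length (filter (λ e → y e ∈ℕ? Y) es) ≤ d * length Y + suc d * length X

  -- Round `i` sweeps from `X` to the Y side and back. While no cycle closes and each round enlarges
  -- the X side by the factor 1 + 1/d, that side has at least (1 + 1/d) ^ i vertices; after `H`
  -- rounds this would exceed `M`, so the growth stalls earlier. The X side has depth 2 i before the
  -- round, so an exchange found in it has length at most 4 (i + 1), hence at most 4 H.
  explore : ∀ {es x y XV YV d ρ M H ℓ} → Unique es → (∀ e → w e ≡ x e * y e) →
            (∀ {e} → e ∈ es → x e ∈ XV) → (∀ {e} → e ∈ es → y e ∈ YV) →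
            length XV ≤ M → d ^ H * M < suc d ^ H → 4 * H ≤ ℓ →
            ∀ k i {U D X Y a b} .{{_ : NonZero a}} .{{_ : NonZero b}} → i + k ≡ H → ρ ∈ X →
            suc d ^ i ≤ d ^ i * length X →
            Tree es x y XV YV U D X Y a b (i + i) (suc (i + i)) →
            Exchange es ℓ ⊎ Ball es x y XV YV d ρ
  explore {XV = XV} {d = d} {M = M} {H} _ _ _ _ XV≤M dH<d′H _ zero i {X = X} i≡H ρ∈X grown t
    rewrite +-identityʳ i | i≡H = contradiction (begin-strict
      suc d ^ H          ≤⟨ grown ⟩
      d ^ H * length X   ≤⟨ *-monoʳ-≤ (d ^ H) (≤-trans (Unique-⊆⇒length-≤ X! X⊆) XV≤M) ⟩
      d ^ H * M          <⟨ dH<d′H ⟩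
      suc d ^ H          ∎) (<-irrefl refl)
    where
    open Tree t
    open ≤-Reasoning
  explore {es} {x} {y} {XV} {YV} {d} {ρ} {M} {H} {ℓ} es! we xV yV XV≤M dH<d′H ℓ≥ (suc k) i
          {U} {D} {X} {Y} {a} {b} i≡H ρ∈X grown t
    with sweep we yV ℓ≥₁ es id t
    where
    ℓ≥₁ : suc (i + i + suc (i + i)) ≤ ℓ
    ℓ≥₁ = begin
      suc (i + i + suc (i + i))      ≤⟨ m≤n+m _ 2 ⟩
      2 + suc (i + i + suc (i + i))  ≡⟨ eq i ⟩
      4 * suc i                      ≤⟨ *-monoʳ-≤ 4 (m+1+n≡o⇒1+m≤o i i≡H) ⟩
      4 * H                          ≤⟨ ℓ≥ ⟩
      ℓ                              ∎
      where
      open ≤-Reasoning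
      eq : ∀ i → 2 + suc (i + i + suc (i + i)) ≡ 4 * suc i
      eq = solve-∀
  ... | inj₁ c = inj₁ c
  ... | inj₂ s
    with sweep (λ e → trans (we e) (*-comm (x e) (y e))) xV ℓ≥₂ es id
               (Tree-flip (m≤n+m _ 2) (Sweep.tree s))
    where
    ℓ≥₂ : suc (suc (i + i) + suc (suc (i + i))) ≤ ℓ
    ℓ≥₂ = ≤-trans (≤-reflexive (eq i)) (≤-trans (*-monoʳ-≤ 4 (m+1+n≡o⇒1+m≤o i i≡H)) ℓ≥)
      where
      eq : ∀ i → suc (suc (i + i) + suc (suc (i + i))) ≡ 4 * suc i
      eq = solve-∀
  ... | inj₁ c = inj₁ c
  ... | inj₂ s′
    with d * length (Sweep.Y′ s′) ≤? suc d * length X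
  -- The ball pairs the old `X` with the new `Y₁`. The second sweep, on the flipped tree, put all
  -- edges at `Y₁` into a tree with fewer than |Y₁| + |X₁| edges, and slow growth bounds |X₁| by (1
  -- + 1/d) |X|.
  ... | yes slow = inj₂ record
    { X = X ; Y = Y₁ ; X! = Tree.X! t ; Y! = Tree.Y! tree₁ ; X⊆ = Tree.X⊆ t ; Y⊆ = Tree.Y⊆ tree₁
    ; root = ρ∈X
    ; closed = λ e∈es xe∈X → proj₂ (Tree.ends tree₁ (done₁ e∈es xe∈X))
    ; few = begin
        d * length touching             ≤⟨ *-monoʳ-≤ d touching≤ ⟩
        d * (length Y₁ + length X₁)     ≡⟨ *-distribˡ-+ d (length Y₁) (length X₁) ⟩
        d * length Y₁ + d * length X₁   ≤⟨ +-monoʳ-≤ _ slow ⟩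
        d * length Y₁ + suc d * length X ∎ }
    where
    open Sweep s using () renaming (D′ to D₁; Y′ to Y₁; tree to tree₁; done to done₁)
    open Sweep s′ using () renaming (D′ to U₁; Y′ to X₁; tree to tree₂; done to done₂)
    open ≤-Reasoning
    touches? : Decidable (λ e → y e ∈ Y₁)
    touches? e = y e ∈ℕ? Y₁
    touching : List E
    touching = filter touches? es
    touching⊆ : touching ⊆ D₁ ++ U₁
    touching⊆ e∈ with e∈es , ye∈Y ← ∈-filter⁻ touches? e∈ with done₂ e∈es ye∈Y
    ... | inj₁ e∈D = ∈-++⁺ˡ e∈D
    ... | inj₂ e∈U = ∈-++⁺ʳ _ e∈U
    touching≤ : length touching ≤ length Y₁ + length X₁
    touching≤ = begin
      length touching              ≤⟨ Unique-⊆⇒length-≤ (Unique.filter⁺ touches? es!) touching⊆ ⟩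
      length (D₁ ++ U₁)            ≡⟨ length-++ D₁ ⟩
      length D₁ + length U₁        ≤⟨ n≤1+n _ ⟩
      suc (length D₁ + length U₁)  ≡⟨ Tree.size tree₂ ⟩
      length Y₁ + length X₁        ∎
  ... | no fast =
    explore es! we xV yV XV≤M dH<d′H ℓ≥ k (suc i) (trans (sym (+-suc i k)) i≡H) (Y⊆Y′ ρ∈X) grown′
            (subst (λ h → Tree es x y XV YV U₁ D₁ X₁ Y₁ a b h (suc h)) (sym (cong suc (+-suc i i)))
                   (Tree-flip (m≤n+m _ 2) tree₂))
    where
    open Sweep s using () renaming (D′ to D₁; Y′ to Y₁)
    open Sweep s′ using (Y⊆Y′) renaming (D′ to U₁; Y′ to X₁; tree to tree₂)
    open ≤-Reasoning
    grown′ : suc d ^ suc i ≤ d ^ suc i * length X₁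
    grown′ = begin
      suc d * suc d ^ i            ≤⟨ *-monoʳ-≤ (suc d) grown ⟩
      suc d * (d ^ i * length X)   ≡⟨ x∙yz≈y∙xz *-commutativeSemigroup (suc d) (d ^ i) _ ⟩
      d ^ i * (suc d * length X)   ≤⟨ *-monoʳ-≤ (d ^ i) (<⇒≤ (≰⇒> fast)) ⟩
      d ^ i * (d * length X₁)      ≡⟨ *-assoc (d ^ i) d _ ⟨
      d ^ i * d * length X₁        ≡⟨ cong (_* length X₁) (*-comm (d ^ i) d) ⟩
      d * d ^ i * length X₁        ∎

  -- Balls are cut off one at a time, each rooted at the end of a remaining edge, and their costs
  -- `few` add up to the edge bound. The recursion is on `n`, as each ball removes at least the edge
  -- `e₀`.
  sparse : ∀ {x y d M H ℓ} → (∀ e → w e ≡ x e * y e) → (∀ e → NonZero (x e)) →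
           d ^ H * M < suc d ^ H → 4 * H ≤ ℓ → ∀ n {es XV YV} → length es ≤ n → Unique es →
           (∀ {e} → e ∈ es → x e ∈ XV) → (∀ {e} → e ∈ es → y e ∈ YV) → length XV ≤ M →
           Exchange es ℓ ⊎ d * length es ≤ d * length YV + suc d * length XV
  sparse {d = d} we x≢0 _ _ _ {[]} _ _ _ _ _ = inj₂ (≤-trans (≤-reflexive (*-zeroʳ d)) z≤n)
  sparse {x} {y} {d} {M} {H} {ℓ} we x≢0 dH<d′H ℓ≥ (suc n) {es@(e₀ ∷ _)} {XV} {YV}
         es≤n es! xV yV XV≤M
    -- The search starts in round 0 from the single vertex `x e₀`. With `a` equal to 1 and `b` equal
    -- to the root, the empty walk satisfies `joins`.
    with explore es! we xV yV XV≤M dH<d′H ℓ≥ H 0 {b = x e₀} {{_}} {{x≢0 e₀}} refl (here refl)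
                 ≤-refl single
    where
    single : Tree es x y XV YV [] [] (x e₀ ∷ []) [] 1 (x e₀) 0 1
    single = record
      { U⊆ = λ () ; D⊆ = λ () ; U∩D = λ () ; X! = [] ∷ [] ; Y! = []
      ; X⊆ = λ { (here refl) → xV (here refl) } ; Y⊆ = λ () ; size = refl
      ; ends = λ { (inj₁ ()) ; (inj₂ ()) }
      ; pathX = λ { (here refl) → record
          { P = [] ; Q = [] ; P⊆ = λ () ; Q⊆ = λ () ; P! = [] ; Q! = [] ; joins = refl
          ; short = z≤n } }
      ; pathY = λ () }
  ... | inj₁ c = inj₁ c
  ... | inj₂ ball = merge
    (sparse {d = d} {H = H} we x≢0 dH<d′H ℓ≥ n rest≤n (Unique.filter⁺ outside es!) rest-x rest-y
            (≤-trans (m+n≤o⇒n≤o (length X) (length-filter-∉ X! X⊆)) XV≤M))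
    where
    open Ball ball
    open ≤-Reasoning
    inside : Decidable (λ e → y e ∈ Y)
    inside e = y e ∈ℕ? Y
    outside : Decidable (λ e → y e ∉ Y)
    outside e = ¬? (inside e)
    rest : List E
    rest = filter outside es
    XV′ YV′ : List ℕ
    XV′ = filter (λ v → ¬? (v ∈ℕ? X)) XV
    YV′ = filter (λ v → ¬? (v ∈ℕ? Y)) YV
    rest≤n : length rest ≤ n
    rest≤n = s≤s⁻¹ (begin
      1 + length rest                              ≤⟨ +-monoˡ-≤ _ nonempty ⟩
      length (filter inside es) + length rest      ≡⟨ length-filter-¬ inside es ⟩
      length es                                    ≤⟨ es≤n ⟩
      suc n                                        ∎)
      where
      nonempty : 1 ≤ length (filter inside es)
      nonempty = ∈-length (∈-filter⁺ inside (here refl) (closed (here refl) root))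
    rest-x : ∀ {e} → e ∈ rest → x e ∈ XV′
    rest-x e∈rest with e∈es , ye∉Y ← ∈-filter⁻ outside e∈rest =
      ∈-filter⁺ _ (xV e∈es) (ye∉Y ∘ closed e∈es)
    rest-y : ∀ {e} → e ∈ rest → y e ∈ YV′
    rest-y e∈rest with e∈es , ye∉Y ← ∈-filter⁻ outside e∈rest = ∈-filter⁺ _ (yV e∈es) ye∉Y
    merge : Exchange rest ℓ ⊎ d * length rest ≤ d * length YV′ + suc d * length XV′ →
            Exchange es ℓ ⊎ d * length es ≤ d * length YV + suc d * length XV
    merge (inj₁ c) = inj₁ (Exchange-⊆ (λ z → proj₁ (∈-filter⁻ outside z)) c)
    merge (inj₂ r) = inj₂ (begin
      d * length es
        ≡⟨ cong (d *_) (length-filter-¬ inside es) ⟨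
      d * (length (filter inside es) + length rest)
        ≡⟨ *-distribˡ-+ d _ (length rest) ⟩
      d * length (filter inside es) + d * length rest
        ≤⟨ +-mono-≤ few r ⟩
      d * length Y + suc d * length X + (d * length YV′ + suc d * length XV′)
        ≡⟨ regroup d (length Y) (length X) (length YV′) (length XV′) ⟩
      d * (length Y + length YV′) + suc d * (length X + length XV′)
        ≤⟨ +-mono-≤ (*-monoʳ-≤ d (length-filter-∉ Y! Y⊆))
                    (*-monoʳ-≤ (suc d) (length-filter-∉ X! X⊆)) ⟩
      d * length YV + suc d * length XV ∎)
      where
      regroup : ∀ d p q r s → d * p + suc d * q + (d * r + suc d * s) ≡
                              d * (p + r) + suc d * (q + s)
      regroup = solve-∀

  -- Families of balanced edge sets from disjoint exchanges

  -- In `injective`, different bit vectors must select different sets, not only different lists,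
  -- since a subset product sees only the set.
  record Family (es : List E) (j : ℕ) : Set where
    field
      select    : Vec Bool j → List E
      select⊆   : ∀ s → select s ⊆ es
      select!   : ∀ s → Unique (select s)
      balanced  : ∀ s t → weight (select s) ≡ weight (select t)
      injective : ∀ s t → select s ⊆ select t → select t ⊆ select s → s ≡ t

  Family-zero : ∀ {es} → Family es 0
  Family-zero = record
    { select = λ _ → [] ; select⊆ = λ _ () ; select! = λ _ → [] ; balanced = λ _ _ → refl
    ; injective = λ { [] [] _ _ → refl } }

  support : ∀ {es ℓ} → Exchange es ℓ → List E
  support c = Exchange.B c ++ Exchange.C c

  unused : ∀ {es ℓ} → Exchange es ℓ → List E
  unused {es} c = filter (λ e → ¬? (e ∈E? support c)) es

  Family-suc : ∀ {es ℓ j} (c : Exchange es ℓ) → Family (unused c) j → Family es (suc j)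
  Family-suc {es} {j = j} c F = record
    { select = select′
    ; select⊆ = λ { (b ∷ s) z →
        [ side⊆ b , (λ z → proj₁ (∈-filter⁻ unused? (select⊆ s z))) ]′ (∈-++⁻ (side b) z) }
    ; select! = λ { (b ∷ s) →
        Unique.++⁺ (side! b) (select! s) (λ { (z , z′) → fresh s z′ (side-support b z) }) }
    ; balanced = λ { (b ∷ s) (b′ ∷ t) → begin
        weight (side b ++ select s)         ≡⟨ weight-++ (side b) (select s) ⟩
        weight (side b) * weight (select s) ≡⟨ cong₂ _*_ (side-balanced b b′) (balanced s t) ⟩
        weight (side b′) * weight (select t) ≡⟨ weight-++ (side b′) (select t) ⟨
        weight (side b′ ++ select t)        ∎ }
    ; injective = inj }
    where
    open Family F
    open Exchange c hiding (balanced)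
    open ≡-Reasoning
    unused? : Decidable (_∉ support c)
    unused? e = ¬? (e ∈E? support c)
    side : Bool → List E
    side true = B
    side false = C
    side⊆ : ∀ b → side b ⊆ es
    side⊆ true = B⊆
    side⊆ false = C⊆
    side! : ∀ b → Unique (side b)
    side! true = B!
    side! false = C!
    side-support : ∀ b → side b ⊆ support c
    side-support true = ∈-++⁺ˡ
    side-support false = ∈-++⁺ʳ B
    side-balanced : ∀ b b′ → weight (side b) ≡ weight (side b′)
    side-balanced true true = refl
    side-balanced true false = Exchange.balanced c
    side-balanced false true = sym (Exchange.balanced c)
    side-balanced false false = refl
    fresh : ∀ s {e} → e ∈ select s → e ∉ support c
    fresh s z = proj₂ (∈-filter⁻ unused? {xs = es} (select⊆ s z))
    drop : ∀ b s t → side b ++ select s ⊆ side b ++ select t → select s ⊆ select t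
    drop b s t sub z with ∈-++⁻ (side b) (sub (∈-++⁺ʳ (side b) z))
    ... | inj₁ z∈side = contradiction (side-support b z∈side) (fresh s z)
    ... | inj₂ z∈t = z∈t
    sides-differ : ∀ s t → ¬ (B ++ select s ⊆ C ++ select t)
    sides-differ s t sub with ∈-++⁻ C (sub (∈-++⁺ˡ witness∈))
    ... | inj₁ z∈C = witness∉ z∈C
    ... | inj₂ z∈t = fresh t z∈t (∈-++⁺ˡ witness∈)
    select′ : Vec Bool (suc j) → List E
    select′ (b ∷ s) = side b ++ select s
    inj : ∀ s t → select′ s ⊆ select′ t → select′ t ⊆ select′ s → s ≡ t
    inj (true ∷ s) (true ∷ t) p q =
      cong (true ∷_) (injective s t (drop true s t p) (drop true t s q))
    inj (false ∷ s) (false ∷ t) p q =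
      cong (false ∷_) (injective s t (drop false s t p) (drop false t s q))
    inj (true ∷ s) (false ∷ t) p q = ⊥-elim (sides-differ s t p)
    inj (false ∷ s) (true ∷ t) p q = ⊥-elim (sides-differ t s q)

  -- Exchanges are removed greedily. Each uses at most `ℓ` edges, so before each of the `j` removals
  -- the remaining edges still exceed the bound of `sparse`, which must then yield another exchange.
  pack : ∀ {x y d M H ℓ} → (∀ e → w e ≡ x e * y e) → (∀ e → NonZero (x e)) →
         d ^ H * M < suc d ^ H → 4 * H ≤ ℓ → ∀ {XV YV} → length XV ≤ M → ∀ j {es} → Unique es →
         (∀ {e} → e ∈ es → x e ∈ XV) → (∀ {e} → e ∈ es → y e ∈ YV) →
         d * length YV + suc d * length XV + d * (j * ℓ) < d * length es → Family es j
  pack _ _ _ _ _ zero _ _ _ _ = Family-zero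
  pack {x} {y} {d} {H = H} {ℓ} we x≢0 dH<d′H ℓ≥ {XV} {YV} XV≤M (suc j) {es} es! xV yV large
    with sparse {x} {y} {d} {H = H} we x≢0 dH<d′H ℓ≥ (length es) ≤-refl es! xV yV XV≤M
  ... | inj₂ few = contradiction large (≤⇒≯ (≤-trans few (m≤m+n _ _)))
  ... | inj₁ c = Family-suc c
    (pack {x} {y} {d} {H = H} we x≢0 dH<d′H ℓ≥ XV≤M j (Unique.filter⁺ unused? es!)
          (λ z → xV (proj₁ (∈-filter⁻ unused? z))) (λ z → yV (proj₁ (∈-filter⁻ unused? z))) large′)
    where
    open Exchange c using (B; C)
    open ≤-Reasoning
    unused? : Decidable (_∉ support c)
    unused? e = ¬? (e ∈E? support c)
    used≤ : length (filter (_∈E? support c) es) ≤ ℓ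
    used≤ = begin
      length (filter (_∈E? support c) es)
        ≤⟨ Unique-⊆⇒length-≤ (Unique.filter⁺ (_∈E? support c) es!)
                             (λ z → proj₂ (∈-filter⁻ (_∈E? support c) {xs = es} z)) ⟩
      length (B ++ C)       ≡⟨ length-++ B ⟩
      length B + length C   ≤⟨ Exchange.short c ⟩
      ℓ                     ∎
    vertices : ℕ
    vertices = d * length YV + suc d * length XV
    large′ : vertices + d * (j * ℓ) < d * length (unused c)
    large′ = +-cancelˡ-< (d * ℓ) _ _ (begin-strict
      d * ℓ + (vertices + d * (j * ℓ))       ≡⟨ regroup d ℓ vertices (j * ℓ) ⟩
      vertices + d * (ℓ + j * ℓ)             <⟨ large ⟩
      d * length es                          ≡⟨ cong (d *_) (length-filter-¬ (_∈E? support c) es) ⟨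
      d * (length (filter (_∈E? support c) es) + length (unused c))
                                             ≤⟨ *-monoʳ-≤ d (+-monoˡ-≤ _ used≤) ⟩
      d * (ℓ + length (unused c))            ≡⟨ *-distribˡ-+ d ℓ _ ⟩
      d * ℓ + d * length (unused c)          ∎)
      where
      regroup : ∀ d l v k → d * l + (v + d * k) ≡ v + d * (l + k)
      regroup = solve-∀

-- Subsets of [N] as lists of elements

value : ∀ {N} → Fin N → ℕ
value i = suc (toℕ i)

elements : ∀ {N} → Subset N → List (Fin N)
elements A = filter (_∈ₛ? A) (allFin _)

elements! : ∀ {N} (A : Subset N) → Unique (elements A)
elements! A = Unique.filter⁺ (_∈ₛ? A) (Unique.allFin⁺ _)

∈-elements⁺ : ∀ {N} {A : Subset N} {i} → i ∈ₛ A → i ∈ elements A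
∈-elements⁺ {A = A} i∈A = ∈-filter⁺ (_∈ₛ? A) (∈-allFin _) i∈A

∈-elements⁻ : ∀ {N} {A : Subset N} {i} → i ∈ elements A → i ∈ₛ A
∈-elements⁻ {N} {A} i∈A = proj₂ (∈-filter⁻ (_∈ₛ? A) {xs = allFin N} i∈A)

length-filter-tabulate : ∀ {n} (A : Subset n) {B : Set} {P : B → Set} (P? : Decidable P)
                         (f : Fin n → B) → (∀ i → P (f i) → i ∈ₛ A) → (∀ i → i ∈ₛ A → P (f i)) →
                         length (filter P? (tabulate f)) ≡ ∣ A ∣
length-filter-tabulate [] P? f to from = refl
length-filter-tabulate (b ∷ A) P? f to from with P? (f zero)
length-filter-tabulate (true ∷ A) P? f to from | yes _ = cong suc
  (length-filter-tabulate A P? (f ∘ suc) (λ i p → drop-there (to (suc i) p))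
                          (λ i → from (suc i) ∘ Vec.there))
length-filter-tabulate (true ∷ A) P? f to from | no ¬p = contradiction (from zero Vec.here) ¬p
length-filter-tabulate (false ∷ A) P? f to from | yes p with () ← to zero p
length-filter-tabulate (false ∷ A) P? f to from | no _ =
  length-filter-tabulate A P? (f ∘ suc) (λ i p → drop-there (to (suc i) p))
                         (λ i → from (suc i) ∘ Vec.there)

length-elements : ∀ {N} (A : Subset N) → length (elements A) ≡ ∣ A ∣
length-elements A = length-filter-tabulate A (_∈ₛ? A) id (λ _ → id) (λ _ → id)

module _ {N : ℕ} where

  open DecMembership (Fin._≟_ {N}) using (_∈?_)

  toSubset : List (Fin N) → Subset N
  toSubset xs = Vec.tabulate (λ i → does (i ∈? xs))

  ∈-toSubset⁺ : ∀ {xs i} → i ∈ xs → i ∈ₛ toSubset xs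
  ∈-toSubset⁺ {xs} {i} i∈xs = lookup⇒[]= i _
    (trans (lookup∘tabulate _ i) (dec-true (i ∈? xs) i∈xs))

  ∈-toSubset⁻ : ∀ {xs i} → i ∈ₛ toSubset xs → i ∈ xs
  ∈-toSubset⁻ {xs} {i} i∈ with i ∈? xs in eq
  ... | yes i∈xs = i∈xs
  ... | no _ with () ← trans (sym ([]=⇒lookup i∈)) (trans (lookup∘tabulate _ i) (cong does eq))

  subsetProduct-toSubset : ∀ {xs} → Unique xs → subsetProduct (toSubset xs) ≡ product (map value xs)
  subsetProduct-toSubset {xs} xs! = product-↭ (↭.map⁺ value (∼bag⇒↭
    (unique∧set⇒bag (elements! (toSubset xs)) xs!
      (mk⇔ (λ z → ∈-toSubset⁻ (∈-elements⁻ z)) (λ z → ∈-elements⁺ (∈-toSubset⁺ z))))))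

-- Multiplicities and the pigeonhole principle

multiplicity : ℕ → List ℕ → ℕ
multiplicity k xs = length (filter (k ≟_) xs)

multiplicity-↭ : ∀ k {xs ys} → xs ↭ ys → multiplicity k xs ≡ multiplicity k ys
multiplicity-↭ k p = ↭.↭-length (↭.filter-↭ (k ≟_) p)

multiplicity-∷ : ∀ k x xs → multiplicity k (x ∷ xs) ≡ multiplicity k (x ∷ []) + multiplicity k xs
multiplicity-∷ k x xs =
  trans (cong length (filter-++ (k ≟_) (x ∷ []) xs)) (length-++ (filter (k ≟_) (x ∷ [])))

∈⇒multiplicity>0 : ∀ {k xs} → k ∈ xs → 0 < multiplicity k xs
∈⇒multiplicity>0 {k} k∈xs = ∈-length (∈-filter⁺ (k ≟_) k∈xs refl)

multiplicity>0⇒∈ : ∀ {k xs} → 0 < multiplicity k xs → k ∈ xs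
multiplicity>0⇒∈ {k} {xs} = first (filter (k ≟_) xs) (∈-filter⁻ (k ≟_))
  where
  first : ∀ zs → (∀ {z} → z ∈ zs → z ∈ xs × k ≡ z) → 0 < length zs → k ∈ xs
  first (z ∷ zs) sound _ with z∈xs , refl ← sound (here refl) = z∈xs

multiplicity⇒↭ : ∀ xs ys → (∀ k → multiplicity k xs ≡ multiplicity k ys) → xs ↭ ys
multiplicity⇒↭ [] [] _ = ↭-refl
multiplicity⇒↭ [] (y ∷ ys) eq =
  contradiction (eq y) (<⇒≢ (∈⇒multiplicity>0 {xs = y ∷ ys} (here refl)))
multiplicity⇒↭ (x ∷ xs) ys eq
  with as , bs , refl ← ∈-∃++ (multiplicity>0⇒∈ {xs = ys}
                          (subst (0 <_) (eq x) (∈⇒multiplicity>0 {xs = x ∷ xs} (here refl)))) =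
  ↭-trans (prep x (multiplicity⇒↭ xs (as ++ bs) eq′)) (↭-sym (↭.shift x as bs))
  where
  open ≡-Reasoning
  eq′ : ∀ k → multiplicity k xs ≡ multiplicity k (as ++ bs)
  eq′ k = +-cancelˡ-≡ (multiplicity k (x ∷ [])) _ _ (begin
    multiplicity k (x ∷ []) + multiplicity k xs          ≡⟨ multiplicity-∷ k x xs ⟨
    multiplicity k (x ∷ xs)                              ≡⟨ eq k ⟩
    multiplicity k (as ++ x ∷ bs)                        ≡⟨ multiplicity-↭ k (↭.shift x as bs) ⟩
    multiplicity k (x ∷ as ++ bs)                        ≡⟨ multiplicity-∷ k x (as ++ bs) ⟩
    multiplicity k (x ∷ []) + multiplicity k (as ++ bs)  ∎)

multiplicity-≥ : ∀ {Y k xs} → All (_< Y) xs → ¬ k < Y → multiplicity k xs ≡ 0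
multiplicity-≥ {k = k} xs<Y k≮Y =
  cong length (filter-none (k ≟_) (All.map (λ { x<Y refl → k≮Y x<Y }) xs<Y))

bits : ∀ j → Fin (2 ^ j) → Vec Bool j
bits zero _ = []
bits (suc j) i = let q , r = remQuot {2} (2 ^ j) i in Inverse.to Fin.2↔Bool q ∷ bits j r

bits-injective : ∀ j {i k} → bits j i ≡ bits j k → i ≡ k
bits-injective zero {zero} {zero} _ = refl
bits-injective (suc j) {i} {k} eq with eq₁ , eq₂ ← ∷-injective eq = begin
  i                                        ≡⟨ Fin.combine-remQuot {2} (2 ^ j) i ⟨
  uncurry combine (remQuot {2} (2 ^ j) i)  ≡⟨ cong₂ combine (Injection.injective (Inverse⇒Injection Fin.2↔Bool) eq₁)
                                                           (bits-injective j eq₂) ⟩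
  uncurry combine (remQuot {2} (2 ^ j) k)  ≡⟨ Fin.combine-remQuot {2} (2 ^ j) k ⟩
  k                                        ∎
  where open ≡-Reasoning

exponents : ∀ {Y K} (xs : List ℕ) → length xs ≤ K → Fin Y → Fin (suc K)
exponents xs xs≤K k = fromℕ< (s≤s (≤-trans (length-filter (toℕ k ≟_) xs) xs≤K))

exponents-injective : ∀ {Y K xs ys} (xs≤K : length xs ≤ K) (ys≤K : length ys ≤ K) →
                      All (_< Y) xs → All (_< Y) ys →
                      (∀ (k : Fin Y) → exponents xs xs≤K k ≡ exponents ys ys≤K k) → xs ↭ ys
exponents-injective {Y} {K} {xs} {ys} xs≤K ys≤K xs<Y ys<Y eq = multiplicity⇒↭ xs ys same
  where
  open ≡-Reasoning
  same : ∀ k → multiplicity k xs ≡ multiplicity k ys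
  same k with k <? Y
  ... | no k≮Y = trans (multiplicity-≥ xs<Y k≮Y) (sym (multiplicity-≥ ys<Y k≮Y))
  ... | yes k<Y = begin
    multiplicity k xs            ≡⟨ cong (λ z → multiplicity z xs) (Fin.toℕ-fromℕ< k<Y) ⟨
    multiplicity (toℕ κ) xs      ≡⟨ Fin.toℕ-fromℕ< _ ⟨
    toℕ (exponents xs xs≤K κ)    ≡⟨ cong toℕ (eq κ) ⟩
    toℕ (exponents ys ys≤K κ)    ≡⟨ Fin.toℕ-fromℕ< _ ⟩
    multiplicity (toℕ κ) ys      ≡⟨ cong (λ z → multiplicity z ys) (Fin.toℕ-fromℕ< k<Y) ⟩
    multiplicity k ys            ∎
    where
    κ : Fin Y
    κ = fromℕ< k<Y

-- Lists of length at most `K` with entries below `Y` have at most (K + 1) ^ Y multiplicity vectors.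
-- Two of the 2 ^ j lists share one, so they are permutations of each other.
product-pigeonhole : ∀ {j Y K} (L : Vec Bool j → List ℕ) → (∀ s → All (_< Y) (L s)) →
                     (∀ s → length (L s) ≤ K) → suc K ^ Y < 2 ^ j →
                     ∃[ s ] ∃[ t ] s ≢ t × product (L s) ≡ product (L t)
product-pigeonhole {j} {Y} {K} L L<Y L≤K large =
  let i , i′ , i<i′ , eq = Fin.pigeonhole large (λ i → funToFin (exps (bits j i)))
  in bits j i , bits j i′ , (λ e → Fin.<⇒≢ i<i′ (bits-injective j e)) ,
     product-↭ (exponents-injective (L≤K _) (L≤K _) (L<Y _) (L<Y _) (λ k →
       trans (sym (Fin.finToFun-funToFin (exps (bits j i)) k))
             (trans (cong (λ z → finToFun z k) eq) (Fin.finToFun-funToFin (exps (bits j i′)) k))))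
  where
  exps : Vec Bool j → Fin Y → Fin (suc K)
  exps s = exponents (L s) (L≤K s)

-- Distinct subset products exclude large families

module _ {N : ℕ} (w : Fin N → ℕ) (smooth : Fin N → List ℕ)
         (splits : ∀ i → value i ≡ w i * product (smooth i)) where

  smoothPart : List (Fin N) → List ℕ
  smoothPart = concatMap smooth

  product-splits : ∀ xs → product (map value xs) ≡ product (map w xs) * product (smoothPart xs)
  product-splits [] = refl
  product-splits (x ∷ xs) = begin
    value x * product (map value xs)
      ≡⟨ cong₂ _*_ (splits x) (product-splits xs) ⟩
    w x * product (smooth x) * (product (map w xs) * product (smoothPart xs))
      ≡⟨ regroup (w x) (product (smooth x)) (product (map w xs)) (product (smoothPart xs)) ⟩
    w x * product (map w xs) * (product (smooth x) * product (smoothPart xs))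
      ≡⟨ cong (w x * product (map w xs) *_) (product-++ (smooth x) (smoothPart xs)) ⟨
    w x * product (map w xs) * product (smooth x ++ smoothPart xs) ∎
    where
    open ≡-Reasoning
    regroup : ∀ a b c d → a * b * (c * d) ≡ a * c * (b * d)
    regroup = solve-∀

  smoothPart-< : ∀ {Y} → (∀ i → All (_< Y) (smooth i)) → ∀ xs → All (_< Y) (smoothPart xs)
  smoothPart-< smooth<Y [] = []
  smoothPart-< smooth<Y (x ∷ xs) = All.++⁺ (smooth<Y x) (smoothPart-< smooth<Y xs)

  length-smoothPart : ∀ {K} → (∀ i → length (smooth i) ≤ K) → ∀ xs →
                      length (smoothPart xs) ≤ length xs * K
  length-smoothPart smooth≤K [] = z≤n
  length-smoothPart smooth≤K (x ∷ xs) = ≤-trans (≤-reflexive (length-++ (smooth x)))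
    (+-mono-≤ (smooth≤K x) (length-smoothPart smooth≤K xs))

  length-smoothPart-! : (∀ i → length (smooth i) ≤ N) → ∀ {xs} → Unique xs →
                        length (smoothPart xs) ≤ N * N
  length-smoothPart-! smooth≤N {xs} xs! =
    ≤-trans (length-smoothPart smooth≤N xs) (*-monoˡ-≤ N (begin
      length xs          ≤⟨ Unique-⊆⇒length-≤ xs! (λ {i} _ → ∈-allFin i) ⟩
      length (allFin N)  ≡⟨ length-tabulate (id {A = Fin N}) ⟩
      N                  ∎))
    where open ≤-Reasoning

  -- All selections agree in the product of the `w`. A smooth part has at most `N * N` factors, at
  -- most `N` from each of at most `N` numbers, so by pigeonhole two selections agree there as well.
  -- These two would be different sets with the same subset product.
  no-large-Family : ∀ {Y j A} → DistinctSubsetProducts A → (∀ i → All (_< Y) (smooth i)) →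
                    (∀ i → length (smooth i) ≤ N) → suc (N * N) ^ Y < 2 ^ j →
                    ¬ Family Fin._≟_ w (elements A) j
  no-large-Family {Y} {j} {A} dsp smooth<Y smooth≤N large F
    with s , t , s≢t , eq ← product-pigeonhole (smoothPart ∘ Family.select F)
                              (smoothPart-< smooth<Y ∘ Family.select F)
                              (λ s → length-smoothPart-! smooth≤N (Family.select! F s)) large =
    s≢t (injective s t (sub same) (sub (sym same)))
    where
    open Family F
    open ≡-Reasoning
    subset : Vec Bool j → Subset N
    subset s = toSubset (select s)
    subset-product : ∀ s → subsetProduct (subset s) ≡
                            product (map w (select s)) * product (smoothPart (select s))
    subset-product s = trans (subsetProduct-toSubset (select! s)) (product-splits (select s))
    same : subset s ≡ subset t
    same = dsp _ _ (λ z → ∈-elements⁻ (select⊆ s (∈-toSubset⁻ z)))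
                   (λ z → ∈-elements⁻ (select⊆ t (∈-toSubset⁻ z))) (begin
      subsetProduct (subset s)                                     ≡⟨ subset-product s ⟩
      product (map w (select s)) * product (smoothPart (select s)) ≡⟨ cong₂ _*_ (balanced s t) eq ⟩
      product (map w (select t)) * product (smoothPart (select t)) ≡⟨ subset-product t ⟨
      subsetProduct (subset t)                                     ∎)
    sub : ∀ {s t} → subset s ≡ subset t → select s ⊆ select t
    sub e z = ∈-toSubset⁻ (subst (_ ∈ₛ_) e (∈-toSubset⁺ z))

-- Splitting off the large prime factors

primesTo : ℕ → List ℕ
primesTo N = filter prime? (upTo (suc N))

sqrtPrime? : ∀ N → Decidable (λ p → Prime p × p * p ≤ N)
sqrtPrime? N p = prime? p ×-dec (p * p ≤? N)

primesToSqrt : ℕ → List ℕ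
primesToSqrt N = filter (sqrtPrime? N) (upTo (suc N))

∈-primesTo⁺ : ∀ {N p} → Prime p → p ≤ N → p ∈ primesTo N
∈-primesTo⁺ pp p≤N = ∈-filter⁺ prime? (∈-upTo⁺ (s≤s p≤N)) pp

∈-primesToSqrt⁺ : ∀ {N p} → Prime p → p * p ≤ N → p ∈ primesToSqrt N
∈-primesToSqrt⁺ {N} {p} pp p²≤N = ∈-filter⁺ (sqrtPrime? N) (∈-upTo⁺ (s≤s p≤N)) (pp , p²≤N)
  where
  p≤N : p ≤ N
  p≤N = ≤-trans (m≤m*n p p {{prime⇒nonZero pp}}) p²≤N

product-filter-¬ : ∀ {P : ℕ → Set} (P? : Decidable P) xs →
                   product (filter P? xs) * product (filter (¬? ∘ P?) xs) ≡ product xs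
product-filter-¬ P? [] = refl
product-filter-¬ P? (x ∷ xs) with P? x
... | yes _ = trans (*-assoc x _ _) (cong (x *_) (product-filter-¬ P? xs))
... | no _  = trans (x∙yz≈y∙xz *-commutativeSemigroup (product (filter P? xs)) x _)
                    (cong (x *_) (product-filter-¬ P? xs))

length<product : ∀ {ps} → All Prime ps → length ps < product ps
length<product [] = ≤-refl
length<product {p ∷ ps} (pp ∷ pps) = begin
  2 + length ps           ≤⟨ m≤n+m _ (length ps) ⟩
  length ps + (2 + length ps) ≡⟨ double (length ps) ⟩
  2 * suc (length ps)     ≤⟨ *-mono-≤ p>1 (length<product pps) ⟩
  p * product ps          ∎
  where
  open ≤-Reasoning
  double : ∀ k → k + (2 + k) ≡ 2 * suc k
  double = solve-∀
  p>1 : 1 < p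
  p>1 = nonTrivial⇒n>1 p {{prime⇒nonTrivial pp}}

record Splitting (Z N n : ℕ) : Set where
  field
    x y     : ℕ
    smooth  : List ℕ
    splits  : n ≡ x * y * product smooth
    x≢0     : NonZero x
    x∈      : x ∈ 1 ∷ primesToSqrt N
    y∈      : y ∈ 1 ∷ primesTo N
    smooth< : All (_< suc (Z ^ 4)) smooth
    smooth≤ : length smooth ≤ N

module _ {Z N n : ℕ} (N<Z¹² : N < Z ^ 12) (n≤N : n ≤ N) where

  -- Three primes above Z ^ 4 would make `n` at least Z ^ 12, which exceeds `N`. Of two large primes
  -- the smaller becomes `x`, because its square is at most their product; a missing prime is
  -- replaced by 1.
  combineFactors : ∀ {big small} → n ≡ product big * product small → All Prime big →
                   All (Z ^ 4 <_) big → 1 ≤ product small → All (_< suc (Z ^ 4)) small →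
                   length small ≤ N → Splitting Z N n
  combineFactors {[]} {small} n≡ [] [] small≥1 small< small≤ = record
    { x = 1 ; y = 1 ; smooth = small ; splits = n≡ ; x≢0 = _ ; x∈ = here refl ; y∈ = here refl
    ; smooth< = small< ; smooth≤ = small≤ }
  combineFactors {p ∷ []} {small} n≡ (pp ∷ []) _ small≥1 small< small≤ = record
    { x = 1 ; y = p ; smooth = small
    ; splits = trans n≡ (cong (_* product small) (*-comm p 1))
    ; x≢0 = _ ; x∈ = here refl
    ; y∈ = there (∈-primesTo⁺ pp (begin
        p                        ≤⟨ m≤m*n p (product small) {{>-nonZero small≥1}} ⟩
        p * product small        ≡⟨ cong (_* product small) (*-identityʳ p) ⟨
        p * 1 * product small    ≡⟨ n≡ ⟨
        n                        ≤⟨ n≤N ⟩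
        N                        ∎))
    ; smooth< = small< ; smooth≤ = small≤ }
    where open ≤-Reasoning
  combineFactors {p ∷ q ∷ []} {small} n≡ (pp ∷ pq ∷ []) _ small≥1 small< small≤
    with ≤-total p q
  ... | inj₁ p≤q = record
    { x = p ; y = q ; smooth = small ; splits = n≡′ ; x≢0 = prime⇒nonZero pp
    ; x∈ = there (∈-primesToSqrt⁺ pp (≤-trans (*-monoʳ-≤ p p≤q) pq≤N))
    ; y∈ = there (∈-primesTo⁺ pq (≤-trans (m≤n*m q p {{prime⇒nonZero pp}}) pq≤N))
    ; smooth< = small< ; smooth≤ = small≤ }
    where
    n≡′ : n ≡ p * q * product small
    n≡′ = trans n≡ (cong (λ z → p * z * product small) (*-identityʳ q))
    pq≤N : p * q ≤ N
    pq≤N = ≤-trans (m≤m*n (p * q) (product small) {{>-nonZero small≥1}})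
                   (≤-trans (≤-reflexive (sym n≡′)) n≤N)
  ... | inj₂ q≤p = record
    { x = q ; y = p ; smooth = small ; splits = n≡′ ; x≢0 = prime⇒nonZero pq
    ; x∈ = there (∈-primesToSqrt⁺ pq (≤-trans (*-monoʳ-≤ q q≤p) qp≤N))
    ; y∈ = there (∈-primesTo⁺ pp (≤-trans (m≤n*m p q {{prime⇒nonZero pq}}) qp≤N))
    ; smooth< = small< ; smooth≤ = small≤ }
    where
    n≡′ : n ≡ q * p * product small
    n≡′ = trans n≡ (cong (_* product small) (trans (cong (p *_) (*-identityʳ q)) (*-comm p q)))
    qp≤N : q * p ≤ N
    qp≤N = ≤-trans (m≤m*n (q * p) (product small) {{>-nonZero small≥1}})
                   (≤-trans (≤-reflexive (sym n≡′)) n≤N)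
  combineFactors {p ∷ q ∷ r ∷ big} {small} n≡ (_ ∷ _ ∷ _ ∷ pbig) (p> ∷ q> ∷ r> ∷ _) small≥1 _ _ =
    contradiction N<Z¹² (≤⇒≯ (begin
      Z ^ 12                                          ≡⟨ ^-distribˡ-+-* Z 4 8 ⟩
      Z ^ 4 * Z ^ 8                                   ≡⟨ cong (Z ^ 4 *_) (^-distribˡ-+-* Z 4 4) ⟩
      Z ^ 4 * (Z ^ 4 * Z ^ 4)
        ≡⟨ cong (λ z → Z ^ 4 * (Z ^ 4 * z)) (*-identityʳ (Z ^ 4)) ⟨
      Z ^ 4 * (Z ^ 4 * (Z ^ 4 * 1))
        ≤⟨ *-mono-≤ (<⇒≤ p>) (*-mono-≤ (<⇒≤ q>) (*-mono-≤ (<⇒≤ r>) (productOfPrimes≥1 pbig))) ⟩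
      p * (q * (r * product big))
        ≤⟨ m≤m*n _ (product small) {{>-nonZero small≥1}} ⟩
      p * (q * (r * product big)) * product small     ≡⟨ n≡ ⟨
      n                                               ≤⟨ n≤N ⟩
      N                                               ∎))
    where open ≤-Reasoning

  split : .{{NonZero n}} → Splitting Z N n
  split = combineFactors (trans isFactorisation (sym (product-filter-¬ big? factors)))
    (All.filter⁺ big? factorsPrime) (All.all-filter big? factors)
    (productOfPrimes≥1 (All.filter⁺ small? factorsPrime))
    (All.map (λ z → s≤s (≮⇒≥ z)) (All.all-filter small? factors))
    (begin
      length (filter small? factors)  ≤⟨ length-filter small? factors ⟩
      length factors                  ≤⟨ <⇒≤ (length<product factorsPrime) ⟩
      product factors                 ≡⟨ isFactorisation ⟨
      n                               ≤⟨ n≤N ⟩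
      N                               ∎)
    where
    open PrimeFactorisation (factorise n)
    open ≤-Reasoning
    big? : Decidable (Z ^ 4 <_)
    big? = Z ^ 4 <?_
    small? : Decidable (λ p → ¬ Z ^ 4 < p)
    small? = ¬? ∘ big?

-- Growth of (1 + 1/d) ^ k

-- The left side is the first two terms of the binomial expansion. Truncation in `k ∸ 1` is harmless
-- at 0, where the factor `k` vanishes.
bernoulli : ∀ d k → d ^ k + k * d ^ (k ∸ 1) ≤ suc d ^ k
bernoulli d zero = ≤-refl
bernoulli d (suc zero) = ≤-reflexive (eq d)
  where
  eq : ∀ d → d * 1 + 1 ≡ suc d * 1
  eq = solve-∀
bernoulli d (suc (suc k)) = begin
  d * (d * d ^ k) + suc (suc k) * (d * d ^ k)      ≤⟨ m≤m+n _ (suc k * d ^ k) ⟩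
  d * (d * d ^ k) + suc (suc k) * (d * d ^ k) + suc k * d ^ k ≡⟨ eq d (d ^ k) k ⟩
  suc d * (d * d ^ k + suc k * d ^ k)              ≤⟨ *-monoʳ-≤ (suc d) (bernoulli d (suc k)) ⟩
  suc d * suc d ^ suc k                            ∎
  where
  open ≤-Reasoning
  eq : ∀ d p k → d * (d * p) + suc (suc k) * (d * p) + suc k * p ≡ suc d * (d * p + suc k * p)
  eq = solve-∀

-- For `k` equal to `d`, both terms in `bernoulli` are d ^ d.
doubling : ∀ d .{{_ : NonZero d}} → 2 * d ^ d ≤ suc d ^ d
doubling (suc d) = ≤-trans (≤-reflexive (eq (suc d) (suc d ^ d))) (bernoulli (suc d) (suc d))
  where
  eq : ∀ d p → 2 * (d * p) ≡ d * p + d * p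
  eq = solve-∀

^-distribʳ-* : ∀ m n k → (m * n) ^ k ≡ m ^ k * n ^ k
^-distribʳ-* m n zero = refl
^-distribʳ-* m n (suc k) = trans (cong (m * n *_) (^-distribʳ-* m n k)) (eq m n (m ^ k) (n ^ k))
  where
  eq : ∀ a b c d → a * b * (c * d) ≡ a * c * (b * d)
  eq = solve-∀

growth : ∀ d .{{_ : NonZero d}} t → 2 ^ t * d ^ (d * t) ≤ suc d ^ (d * t)
growth d t = begin
  2 ^ t * d ^ (d * t)    ≡⟨ cong (2 ^ t *_) (^-*-assoc d d t) ⟨
  2 ^ t * (d ^ d) ^ t    ≡⟨ ^-distribʳ-* 2 (d ^ d) t ⟨
  (2 * d ^ d) ^ t        ≤⟨ ^-monoˡ-≤ t (doubling d) ⟩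
  (suc d ^ d) ^ t        ≡⟨ ^-*-assoc (suc d) d t ⟩
  suc d ^ (d * t)        ∎
  where open ≤-Reasoning

-- The upper bound

primesToSqrt-≤ : ∀ {N Z} → N < Z ^ 12 → primeCountSqrt N ≤ Z ^ 6
primesToSqrt-≤ {N} {Z} N<Z¹² = ≤-trans
  (Unique-⊆⇒length-≤ (Unique.filter⁺ (sqrtPrime? N) (Unique.upTo⁺ (suc N))) ⊆upTo)
  (≤-reflexive (length-upTo (Z ^ 6)))
  where
  open ≤-Reasoning
  ⊆upTo : primesToSqrt N ⊆ upTo (Z ^ 6)
  ⊆upTo {p} p∈ with _ , _ , p²≤N ← ∈-filter⁻ (sqrtPrime? N) {xs = upTo (suc N)} p∈ =
    ∈-upTo⁺ (≰⇒> (λ Z⁶≤p → <-irrefl refl (begin-strict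
      Z ^ 12           ≡⟨ ^-distribˡ-+-* Z 6 6 ⟩
      Z ^ 6 * Z ^ 6    ≤⟨ *-mono-≤ Z⁶≤p Z⁶≤p ⟩
      p * p            ≤⟨ p²≤N ⟩
      N                <⟨ N<Z¹² ⟩
      Z ^ 12           ∎)))

length-primesToSqrt-≤ : ∀ N → length (1 ∷ primesToSqrt N) ≤ 2 + N
length-primesToSqrt-≤ N = s≤s (≤-trans (length-filter (sqrtPrime? N) (upTo (suc N)))
                                       (≤-reflexive (length-upTo (suc N))))

-- A larger `A` would let `pack` find `j` disjoint exchanges, too many for `no-large-Family`. In the
-- error term the product is `j * ℓ`, the edges used by exchanges; `Z ^ 5` is the surcharge of 1/Z
-- on at most Z ^ 6 vertices; and 3 covers the vertex 1 on either side and a rounding.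
upper-bound : ∀ {N Z t} .{{_ : NonZero Z}} {A : Subset N} → DistinctSubsetProducts A →
              N < Z ^ 12 → N < 2 ^ t →
              ∣ A ∣ ≤ primeCount N + primeCountSqrt N +
                      (3 + Z ^ 5 + suc (t * 2 * suc (Z ^ 4)) * (4 * (Z * (2 + t))))
upper-bound {N} {Z} {t} {A} dsp N<Z¹² N<2ᵗ = ≮⇒≥ λ many →
  no-large-Family w smooth splits dsp smooth< smooth≤ exponents-few
    (pack Fin._≟_ w {x} {y} {Z} {M} {H} (λ _ → refl) x≢0 ball-stops ≤-refl
          (length-primesToSqrt-≤ N) j (elements! A) (λ {i} _ → x∈ i) (λ {i} _ → y∈ i) (vertices-few many))
  where
  open ≤-Reasoning
  module S (i : Fin N) = Splitting (split {Z} {N} {value i} N<Z¹² (Fin.toℕ<n i))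
  open S
  w : Fin N → ℕ
  w i = x i * y i
  j ℓ H M : ℕ
  -- Since N * N + 1 is at most 2 ^ (2 t), this many bits outnumber the multiplicity vectors of the
  -- smooth parts.
  j = suc (t * 2 * suc (Z ^ 4))
  -- By `growth`, this many rounds multiply the X side by at least 2 ^ (2 + t), which is more than
  -- `2 + N`.
  H = Z * (2 + t)
  ℓ = 4 * H
  M = 2 + N
  exponents-few : suc (N * N) ^ suc (Z ^ 4) < 2 ^ j
  exponents-few = begin-strict
    suc (N * N) ^ suc (Z ^ 4)     ≤⟨ ^-monoˡ-≤ (suc (Z ^ 4)) (begin
      suc (N * N)                   ≤⟨ s≤s (*-monoʳ-≤ N (n≤1+n N)) ⟩
      suc (N * suc N)               ≤⟨ s≤s (m≤n+m _ N) ⟩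
      suc N * suc N                 ≤⟨ *-mono-≤ N<2ᵗ N<2ᵗ ⟩
      2 ^ t * 2 ^ t                 ≡⟨ cong (2 ^ t *_) (*-identityʳ (2 ^ t)) ⟨
      (2 ^ t) ^ 2                   ≡⟨ ^-*-assoc 2 t 2 ⟩
      2 ^ (t * 2)                   ∎) ⟩
    (2 ^ (t * 2)) ^ suc (Z ^ 4)   ≡⟨ ^-*-assoc 2 (t * 2) (suc (Z ^ 4)) ⟩
    2 ^ (t * 2 * suc (Z ^ 4))     <⟨ ^-monoʳ-< 2 ≤-refl (n<1+n (t * 2 * suc (Z ^ 4))) ⟩
    2 ^ j                         ∎
  ball-stops : Z ^ H * M < suc Z ^ H
  ball-stops = begin-strict
    Z ^ H * M              <⟨ *-monoʳ-< (Z ^ H) {{m^n≢0 Z H}} M< ⟩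
    Z ^ H * 2 ^ (2 + t)    ≡⟨ *-comm (Z ^ H) _ ⟩
    2 ^ (2 + t) * Z ^ H    ≤⟨ growth Z (2 + t) ⟩
    suc Z ^ H              ∎
    where
    M< : M < 2 ^ (2 + t)
    M< = begin-strict
      2 + N                <⟨ s≤s (s≤s N<2ᵗ) ⟩
      2 + 2 ^ t            ≤⟨ +-monoˡ-≤ (2 ^ t) (*-monoʳ-≤ 2 (m^n>0 2 t)) ⟩
      2 * 2 ^ t + 2 ^ t    ≤⟨ +-monoʳ-≤ (2 * 2 ^ t) (m≤m+n (2 ^ t) (2 ^ t + 0)) ⟩
      2 * 2 ^ t + 2 * 2 ^ t  ≡⟨ cong (2 * 2 ^ t +_) (+-identityʳ (2 * 2 ^ t)) ⟨
      2 ^ (2 + t)          ∎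
  π √π : ℕ
  π = primeCount N
  √π = primeCountSqrt N
  vertices-few : π + √π + (3 + Z ^ 5 + j * ℓ) < ∣ A ∣ →
                 Z * suc π + suc Z * suc √π + Z * (j * ℓ) < Z * length (elements A)
  vertices-few many = begin-strict
    Z * suc π + (suc √π + Z * suc √π) + Z * (j * ℓ)
      ≤⟨ +-monoˡ-≤ (Z * (j * ℓ)) (+-monoʳ-≤ (Z * suc π) (+-monoˡ-≤ (Z * suc √π) (begin
        suc √π             ≤⟨ s≤s (primesToSqrt-≤ {Z = Z} N<Z¹²) ⟩
        suc (Z ^ 6)        ≤⟨ +-monoˡ-≤ (Z ^ 6) (>-nonZero⁻¹ Z) ⟩
        Z + Z * Z ^ 5      ∎))) ⟩
    Z * suc π + (Z + Z * Z ^ 5 + Z * suc √π) + Z * (j * ℓ)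
      ≡⟨ regroup Z π √π (Z ^ 5) (j * ℓ) ⟩
    Z * (π + √π + (3 + Z ^ 5 + j * ℓ))
      <⟨ *-monoʳ-< Z many ⟩
    Z * ∣ A ∣
      ≡⟨ cong (Z *_) (length-elements A) ⟨
    Z * length (elements A) ∎
    where
    regroup : ∀ z p q a b → z * suc p + (z + z * a + z * suc q) + z * b ≡
                            z * (p + q + (3 + a + b))
    regroup = solve-∀


-- The lower bound: primes and their squares

multiplicity-≡ : ∀ k → multiplicity k (k ∷ []) ≡ 1
multiplicity-≡ k = cong length (filter-accept (k ≟_) {xs = []} refl)

multiplicity-≢ : ∀ {k x} → k ≢ x → multiplicity k (x ∷ []) ≡ 0
multiplicity-≢ {k} k≢x = cong length (filter-reject (k ≟_) {xs = []} k≢x)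

multiplicity-! : ∀ {k xs} → Unique xs → multiplicity k xs ≤ 1
multiplicity-! {k} {xs} xs! = Unique-⊆⇒length-≤ (Unique.filter⁺ (k ≟_) xs!) only
  where
  only : filter (k ≟_) xs ⊆ k ∷ []
  only z with _ , refl ← ∈-filter⁻ (k ≟_) {xs = xs} z = here refl

square-injective : ∀ {p q} → p * p ≡ q * q → p ≡ q
square-injective {p} {q} eq with <-cmp p q
... | tri< p<q _ _ = contradiction eq (<⇒≢ (*-mono-< p<q p<q))
... | tri≈ _ p≡q _ = p≡q
... | tri> _ _ q<p = contradiction (sym eq) (<⇒≢ (*-mono-< q<p q<p))

prime≢square : ∀ {p q} → Prime p → Prime q → p ≢ q * q
prime≢square {p} {q} pp pq refl with prime⇒irreducible pp (divides q refl)
... | inj₁ refl = ¬prime[1] pq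
... | inj₂ q≡q² with refl ← *-cancelˡ-≡ 1 q q {{prime⇒nonZero pq}} (trans (*-identityʳ q) q≡q²) =
  ¬prime[1] pq

PrimeOrSquare : ℕ → Set
PrimeOrSquare n = Prime n ⊎ (∃[ q ] Prime q × n ≡ q * q)

¬PrimeOrSquare-0 : ¬ PrimeOrSquare 0
¬PrimeOrSquare-0 (inj₁ p0) = ¬prime[0] p0
¬PrimeOrSquare-0 (inj₂ (q@(suc _) , _ , ()))
¬PrimeOrSquare-0 (inj₂ (zero , p0 , _)) = ¬prime[0] p0

-- The factorisation is built explicitly, one factor per prime and two per square, so that its
-- exponents can be read off; `factorisationUnique` later compares it with another one.
valuation : ∀ {ns} → All PrimeOrSquare ns → ∃[ F ] ∀ {p} → Prime p →
            multiplicity p (PrimeFactorisation.factors {product ns} F) ≡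
            multiplicity p ns + 2 * multiplicity (p * p) ns
valuation [] = primeFactorisation[1] , λ _ → refl
valuation {n ∷ ns} (inj₁ pn ∷ good) with F , val ← valuation good =
  record { factors = n ∷ factors ; isFactorisation = cong (n *_) isFactorisation
         ; factorsPrime = pn ∷ factorsPrime } ,
  λ {p} pp → begin
    multiplicity p (n ∷ factors)
      ≡⟨ multiplicity-∷ p n factors ⟩
    multiplicity p (n ∷ []) + multiplicity p factors
      ≡⟨ cong (multiplicity p (n ∷ []) +_) (val pp) ⟩
    multiplicity p (n ∷ []) + (multiplicity p ns + 2 * multiplicity (p * p) ns)
      ≡⟨ +-assoc (multiplicity p (n ∷ [])) _ _ ⟨
    multiplicity p (n ∷ []) + multiplicity p ns + 2 * multiplicity (p * p) ns
      ≡⟨ cong (λ z → multiplicity p (n ∷ []) + multiplicity p ns +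
                     2 * (z + multiplicity (p * p) ns))
              (multiplicity-≢ (≢-sym (prime≢square pn pp))) ⟨
    multiplicity p (n ∷ []) + multiplicity p ns +
      2 * (multiplicity (p * p) (n ∷ []) + multiplicity (p * p) ns)
      ≡⟨ cong₂ (λ s t → s + 2 * t) (multiplicity-∷ p n ns) (multiplicity-∷ (p * p) n ns) ⟨
    multiplicity p (n ∷ ns) + 2 * multiplicity (p * p) (n ∷ ns) ∎
  where
  open PrimeFactorisation F
  open ≡-Reasoning
valuation {_ ∷ ns} (inj₂ (q , pq , refl) ∷ good) with F , val ← valuation good =
  record { factors = q ∷ q ∷ factors
         ; isFactorisation = trans (cong (q * q *_) isFactorisation) (*-assoc q q _)
         ; factorsPrime = pq ∷ pq ∷ factorsPrime } ,
  λ {p} pp → begin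
    multiplicity p (q ∷ q ∷ factors)
      ≡⟨ multiplicity-∷ p q (q ∷ factors) ⟩
    multiplicity p (q ∷ []) + multiplicity p (q ∷ factors)
      ≡⟨ cong (multiplicity p (q ∷ []) +_) (multiplicity-∷ p q factors) ⟩
    multiplicity p (q ∷ []) + (multiplicity p (q ∷ []) + multiplicity p factors)
      ≡⟨ cong (λ z → multiplicity p (q ∷ []) + (multiplicity p (q ∷ []) + z)) (val pp) ⟩
    multiplicity p (q ∷ []) +
      (multiplicity p (q ∷ []) + (multiplicity p ns + 2 * multiplicity (p * p) ns))
      ≡⟨ regroup (multiplicity p (q ∷ [])) (multiplicity p ns) (multiplicity (p * p) ns) ⟩
    multiplicity p ns + 2 * (multiplicity p (q ∷ []) + multiplicity (p * p) ns)
      ≡⟨ cong₂ (λ s t → s + multiplicity p ns + 2 * (t + multiplicity (p * p) ns))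
               (multiplicity-≢ (prime≢square pp pq)) (squares p) ⟨
    multiplicity p (q * q ∷ []) + multiplicity p ns +
      2 * (multiplicity (p * p) (q * q ∷ []) + multiplicity (p * p) ns)
      ≡⟨ cong₂ (λ s t → s + 2 * t) (multiplicity-∷ p (q * q) ns)
                                   (multiplicity-∷ (p * p) (q * q) ns) ⟨
    multiplicity p (q * q ∷ ns) + 2 * multiplicity (p * p) (q * q ∷ ns) ∎
  where
  open PrimeFactorisation F
  open ≡-Reasoning
  regroup : ∀ a b c → a + (a + (b + 2 * c)) ≡ b + 2 * (a + c)
  regroup = solve-∀
  squares : ∀ p → multiplicity (p * p) (q * q ∷ []) ≡ multiplicity p (q ∷ [])
  squares p = case p ≟ q of λ
    { (yes refl) → trans (multiplicity-≡ (p * p)) (sym (multiplicity-≡ p))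
    ; (no p≢q) → trans (multiplicity-≢ (p≢q ∘ square-injective)) (sym (multiplicity-≢ p≢q)) }

-- The parity of `a + 2 * b` decides whether `a` is 0 or 1.
binary-digits : ∀ {a a′ b b′} → a ≤ 1 → a′ ≤ 1 → a + 2 * b ≡ a′ + 2 * b′ → a ≡ a′ × b ≡ b′
binary-digits {b = b} {b′} z≤n z≤n eq = refl , *-cancelˡ-≡ b b′ 2 eq
binary-digits {b = b} {b′} (s≤s z≤n) (s≤s z≤n) eq = refl , *-cancelˡ-≡ b b′ 2 (suc-injective eq)
binary-digits {b = b} {b′} z≤n (s≤s z≤n) eq = contradiction eq (even≢odd b b′)
binary-digits {b = b} {b′} (s≤s z≤n) z≤n eq = contradiction (sym eq) (even≢odd b′ b)

factors-subst : ∀ {m n} (m≡n : m ≡ n) (F : PrimeFactorisation m) →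
                PrimeFactorisation.factors (subst PrimeFactorisation m≡n F) ≡
                PrimeFactorisation.factors F
factors-subst refl _ = refl

-- Equal products have the same exponent of each prime p. As no number repeats, `binary-digits`
-- recovers from it the multiplicities of p and of p * p.
product-determines : ∀ {ms ns} → Unique ms → Unique ns → All PrimeOrSquare ms →
                     All PrimeOrSquare ns → product ms ≡ product ns → ms ⊆ ns
product-determines {ms} {ns} ms! ns! ms-good ns-good eq {n} n∈ms =
  transfer (All.lookup ms-good n∈ms)
  where
  open PrimeFactorisation using (factors)
  F : PrimeFactorisation (product ms)
  F = proj₁ (valuation ms-good)
  G : PrimeFactorisation (product ns)
  G = proj₁ (valuation ns-good)
  factors-≡ : ∀ p → multiplicity p (factors F) ≡ multiplicity p (factors G)
  factors-≡ p = trans (multiplicity-↭ p (factorisationUnique F (subst PrimeFactorisation (sym eq) G)))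
                      (cong (multiplicity p) (factors-subst (sym eq) G))
  agree : ∀ {p} → Prime p → multiplicity p ms ≡ multiplicity p ns ×
                            multiplicity (p * p) ms ≡ multiplicity (p * p) ns
  agree {p} pp = binary-digits (multiplicity-! ms!) (multiplicity-! ns!) (begin
    multiplicity p ms + 2 * multiplicity (p * p) ms  ≡⟨ proj₂ (valuation ms-good) pp ⟨
    multiplicity p (factors F)                       ≡⟨ factors-≡ p ⟩
    multiplicity p (factors G)                       ≡⟨ proj₂ (valuation ns-good) pp ⟩
    multiplicity p ns + 2 * multiplicity (p * p) ns  ∎)
    where open ≡-Reasoning
  transfer : PrimeOrSquare n → n ∈ ns
  transfer (inj₁ pn) =
    multiplicity>0⇒∈ {xs = ns} (subst (0 <_) (proj₁ (agree pn)) (∈⇒multiplicity>0 n∈ms))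
  transfer (inj₂ (q , pq , refl)) =
    multiplicity>0⇒∈ {xs = ns} (subst (0 <_) (proj₂ (agree pq)) (∈⇒multiplicity>0 n∈ms))

value-injective : ∀ {N} {i j : Fin N} → value i ≡ value j → i ≡ j
value-injective eq = Fin.toℕ-injective (suc-injective eq)

values : ∀ {N} → Subset N → List ℕ
values B = map value (elements B)

DSP-PrimeOrSquare : ∀ {N} {A : Subset N} → (∀ {i} → i ∈ₛ A → PrimeOrSquare (value i)) →
                    DistinctSubsetProducts A
DSP-PrimeOrSquare {N} {A} good B C B⊆A C⊆A eq = ⊆-antisym (sub B⊆A C⊆A eq) (sub C⊆A B⊆A (sym eq))
  where
  values! : ∀ (B : Subset N) → Unique (values B)
  values! B = Unique.map⁺ value-injective (elements! B)
  values-good : ∀ {B} → B ⊆ₛ A → All PrimeOrSquare (values B)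
  values-good {B} B⊆A = All.tabulate λ n∈ → let i , i∈ , eq = ∈-map⁻ value n∈ in
    subst PrimeOrSquare (sym eq) (good (B⊆A (∈-elements⁻ i∈)))
  sub : ∀ {B C} → B ⊆ₛ A → C ⊆ₛ A → subsetProduct B ≡ subsetProduct C → B ⊆ₛ C
  sub {B} {C} B⊆A C⊆A eq {i} i∈B
    with k , k∈C , e ← ∈-map⁻ value (product-determines (values! B) (values! C) (values-good B⊆A)
                          (values-good C⊆A) eq (∈-map⁺ value (∈-elements⁺ i∈B)))
    with refl ← value-injective e = ∈-elements⁻ k∈C

primesAndSquares : ℕ → List ℕ
primesAndSquares N = primesTo N ++ map (λ p → p * p) (primesToSqrt N)

primesAndSquares-good : ∀ {N n} → n ∈ primesAndSquares N → PrimeOrSquare n × n ≤ N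
primesAndSquares-good {N} n∈ with ∈-++⁻ (primesTo N) n∈
... | inj₁ n∈P with n∈upTo , pn ← ∈-filter⁻ prime? {xs = upTo (suc N)} n∈P =
  inj₁ pn , s≤s⁻¹ (∈-upTo⁻ n∈upTo)
... | inj₂ n∈S with q , q∈ , refl ← ∈-map⁻ (λ p → p * p) n∈S
  with _ , pq , q²≤N ← ∈-filter⁻ (sqrtPrime? N) {xs = upTo (suc N)} q∈ = inj₂ (q , pq , refl) , q²≤N

primesAndSquares! : ∀ N → Unique (primesAndSquares N)
primesAndSquares! N = Unique.++⁺ (Unique.filter⁺ prime? (Unique.upTo⁺ (suc N)))
  (Unique.map⁺ square-injective (Unique.filter⁺ (sqrtPrime? N) (Unique.upTo⁺ (suc N)))) disjoint
  where
  disjoint : ∀ {n} → ¬ (n ∈ primesTo N × n ∈ map (λ p → p * p) (primesToSqrt N))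
  disjoint (n∈P , n∈S) with q , q∈ , refl ← ∈-map⁻ (λ p → p * p) n∈S =
    prime≢square (proj₂ (∈-filter⁻ prime? {xs = upTo (suc N)} n∈P))
                 (proj₁ (proj₂ (∈-filter⁻ (sqrtPrime? N) {xs = upTo (suc N)} q∈))) refl

lower-bound : ∀ N → ∃[ A ] DistinctSubsetProducts {N} A × primeCount N + primeCountSqrt N ≤ ∣ A ∣
lower-bound N = A , DSP-PrimeOrSquare (λ i∈A → proj₁ (primesAndSquares-good {N} (∈A⁻ i∈A))) , (begin
  primeCount N + primeCountSqrt N
    ≡⟨ cong (primeCount N +_) (length-map (λ p → p * p) (primesToSqrt N)) ⟨
  primeCount N + length (map (λ p → p * p) (primesToSqrt N))
    ≡⟨ length-++ (primesTo N) ⟨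
  length (primesAndSquares N)
    ≤⟨ Unique-⊆⇒length-≤ (primesAndSquares! N) covered ⟩
  length (values A)
    ≡⟨ length-map value (elements A) ⟩
  length (elements A)
    ≡⟨ length-elements A ⟩
  ∣ A ∣ ∎)
  where
  open ≤-Reasoning
  A : Subset N
  A = Vec.tabulate (λ i → does (value i ∈ℕ? primesAndSquares N))
  ∈A⁺ : ∀ {i} → value i ∈ primesAndSquares N → i ∈ₛ A
  ∈A⁺ {i} v∈ = lookup⇒[]= i _ (trans (lookup∘tabulate _ i) (dec-true (value i ∈ℕ? _) v∈))
  ∈A⁻ : ∀ {i} → i ∈ₛ A → value i ∈ primesAndSquares N
  ∈A⁻ {i} i∈A with value i ∈ℕ? primesAndSquares N in eq
  ... | yes v∈ = v∈
  ... | no _ with () ← trans (sym ([]=⇒lookup i∈A)) (trans (lookup∘tabulate _ i) (cong does eq))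
  covered : primesAndSquares N ⊆ values A
  -- Values start at 1, so 0 has to be excluded: it is neither a prime nor the square of one.
  covered {zero} n∈ = contradiction (proj₁ (primesAndSquares-good {N} n∈)) ¬PrimeOrSquare-0
  covered {suc n} n∈ = subst (_∈ values A) value≡
      (∈-map⁺ value (∈-elements⁺ (∈A⁺ (subst (_∈ primesAndSquares N) (sym value≡) n∈))))
    where
    n<N : n < N
    n<N = proj₂ (primesAndSquares-good {N} n∈)
    value≡ : value (fromℕ< n<N) ≡ suc n
    value≡ = cong suc (Fin.toℕ-fromℕ< n<N)

-- Choice of parameters and the final estimate

-- Supplies the integer twelfth root and the binary logarithm of `N`.
bracket : ∀ (f : ℕ → ℕ) → (∀ k → f k < f (suc k)) → ∀ N → f 0 ≤ N → ∃[ k ] f k ≤ N × N < f (suc k)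
bracket f f↑ zero f0≤N = 0 , f0≤N , ≤-<-trans z≤n (f↑ 0)
bracket f f↑ (suc N) f0≤N with f 0 ≤? N
... | no f0≰N = 0 , f0≤N , ≤-<-trans (≰⇒> f0≰N) (f↑ 0)
... | yes f0≤ with k , fk≤N , N<fk⁺ ← bracket f f↑ N f0≤ with suc N <? f (suc k)
...   | yes N⁺<fk⁺ = k , m≤n⇒m≤1+n fk≤N , N⁺<fk⁺
...   | no N⁺≮fk⁺ = suc k , ≮⇒≥ N⁺≮fk⁺ , ≤-<-trans N<fk⁺ (f↑ (suc k))

suc-≤-2^ : ∀ k → suc k ≤ 2 ^ k
suc-≤-2^ zero = ≤-refl
suc-≤-2^ (suc k) = begin
  suc (suc k)      ≤⟨ +-mono-≤ (m^n>0 2 k) (suc-≤-2^ k) ⟩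
  2 ^ k + 2 ^ k    ≡⟨ cong (2 ^ k +_) (+-identityʳ (2 ^ k)) ⟨
  2 ^ suc k        ∎
  where open ≤-Reasoning

-- With q the quotient of `t` by `s`, t is at most s (q + 1), hence at most s 2 ^ q, and (2 ^ q) ^ s
-- is at most 2 ^ t. This absorbs powers of log N into N ^ ε.
power≤exponential : ∀ s .{{_ : NonZero s}} t → t ^ s ≤ s ^ s * 2 ^ t
power≤exponential s t = begin
  t ^ s                      ≤⟨ ^-monoˡ-≤ s t≤ ⟩
  (s * 2 ^ (t / s)) ^ s      ≡⟨ ^-distribʳ-* s (2 ^ (t / s)) s ⟩
  s ^ s * (2 ^ (t / s)) ^ s  ≡⟨ cong (s ^ s *_) (^-*-assoc 2 (t / s) s) ⟩
  s ^ s * 2 ^ (t / s * s)    ≤⟨ *-monoʳ-≤ (s ^ s) (^-monoʳ-≤ 2 (m/n*n≤m t s)) ⟩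
  s ^ s * 2 ^ t              ∎
  where
  open ≤-Reasoning
  t≤ : t ≤ s * 2 ^ (t / s)
  t≤ = begin
    t                        ≡⟨ m≡m%n+[m/n]*n t s ⟩
    t % s + t / s * s        ≤⟨ +-monoˡ-≤ (t / s * s) (<⇒≤ (m%n<n t s)) ⟩
    suc (t / s) * s          ≤⟨ *-monoˡ-≤ s (suc-≤-2^ (t / s)) ⟩
    2 ^ (t / s) * s          ≡⟨ *-comm (2 ^ (t / s)) s ⟩
    s * 2 ^ (t / s)          ∎

m≤m^n : ∀ m n .{{_ : NonZero m}} .{{_ : NonZero n}} → m ≤ m ^ n
m≤m^n m (suc n) = m≤m*n m (m ^ n) {{m^n≢0 m n}}

-- The constant is 4 + 16: the terms `3 + Z ^ 5` are at most 4 Z ^ 5, and at most 4 Z ^ 4 (2 + t)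
-- exchanges have length 4 Z (2 + t) each.
error-bound : ∀ Z t .{{_ : NonZero Z}} →
              3 + Z ^ 5 + suc (t * 2 * suc (Z ^ 4)) * (4 * (Z * (2 + t))) ≤
              20 * (Z ^ 5 * (2 + t) ^ 2)
error-bound Z t = begin
  3 + Z ^ 5 + suc (t * 2 * suc e) * (4 * (Z * T))
    ≤⟨ +-mono-≤ (+-monoˡ-≤ (Z ^ 5) (*-monoʳ-≤ 3 (m^n>0 Z 5))) (*-monoˡ-≤ (4 * (Z * T)) factor) ⟩
  3 * Z ^ 5 + Z ^ 5 + 4 * (e * T) * (4 * (Z * T))
    ≡⟨ collect Z e T ⟩
  4 * (Z ^ 5 * 1) + 16 * (Z ^ 5 * T ^ 2)
    ≤⟨ +-monoˡ-≤ (16 * (Z ^ 5 * T ^ 2)) (*-monoʳ-≤ 4 (*-monoʳ-≤ (Z ^ 5) (m^n>0 T 2))) ⟩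
  4 * (Z ^ 5 * T ^ 2) + 16 * (Z ^ 5 * T ^ 2)
    ≡⟨ *-distribʳ-+ (Z ^ 5 * T ^ 2) 4 16 ⟨
  20 * (Z ^ 5 * T ^ 2) ∎
  where
  open ≤-Reasoning
  e T : ℕ
  e = Z ^ 4
  T = 2 + t
  collect : ∀ Z e T → 3 * (Z * e) + Z * e + 4 * (e * T) * (4 * (Z * T)) ≡
                      4 * (Z * e * 1) + 16 * (Z * e * (T * (T * 1)))
  collect = solve-∀
  factor : suc (t * 2 * suc e) ≤ 4 * (e * T)
  factor = begin
    1 + t * 2 * (1 + e)      ≤⟨ +-mono-≤ (m^n>0 Z 4) (*-monoʳ-≤ (t * 2) (+-monoˡ-≤ e (m^n>0 Z 4))) ⟩
    e + t * 2 * (e + e)      ≤⟨ m≤m+n _ (7 * e) ⟩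
    e + t * 2 * (e + e) + 7 * e ≡⟨ eq t e ⟩
    4 * (e * T)              ∎
    where
    eq : ∀ t e → e + t * 2 * (e + e) + 7 * e ≡ 4 * (e * (2 + t))
    eq = solve-∀

deviation : ∀ {N m Z t} .{{_ : NonZero Z}} → IsLargestDSPSize N m → N < Z ^ 12 → N < 2 ^ t →
            ∣ m - (primeCount N + primeCountSqrt N) ∣ ≤ 20 * (Z ^ 5 * (2 + t) ^ 2)
deviation {N} {m} {Z} {t} ((A , dsp , refl) , largest) N<Z¹² N<2ᵗ
  with B , dsp′ , π≤ ← lower-bound N = begin
  ∣ m - (primeCount N + primeCountSqrt N) ∣  ≡⟨ m≤n⇒∣n-m∣≡n∸m (≤-trans π≤ (largest B dsp′)) ⟩
  m ∸ (primeCount N + primeCountSqrt N)      ≤⟨ m≤n+o⇒m∸n≤o _ _ m≤ ⟩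
  _                                          ≤⟨ error-bound Z t ⟩
  20 * (Z ^ 5 * (2 + t) ^ 2)                 ∎
  where
  open ≤-Reasoning
  m≤ = upper-bound {N} {Z} {t} dsp N<Z¹² N<2ᵗ

combine-bounds : ∀ K L c {D x X y R S} Q → D ≤ K * (x * y) → x ≤ L * X → X ^ Q ≤ R →
                 y ^ Q ≤ c ^ Q * S → D ^ Q ≤ (K * L * c) ^ Q * (R * S)
combine-bounds K L c {D} {x} {X} {y} {R} {S} Q D≤ x≤ X≤ y≤ = begin
  D ^ Q                              ≤⟨ ^-monoˡ-≤ Q D≤ ⟩
  (K * (x * y)) ^ Q                  ≤⟨ ^-monoˡ-≤ Q (*-monoʳ-≤ K (*-monoˡ-≤ y x≤)) ⟩
  (K * (L * X * y)) ^ Q              ≡⟨ cong (_^ Q) (regroup K L X y) ⟩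
  (K * L * (X * y)) ^ Q              ≡⟨ ^-distribʳ-* (K * L) (X * y) Q ⟩
  (K * L) ^ Q * (X * y) ^ Q          ≡⟨ cong ((K * L) ^ Q *_) (^-distribʳ-* X y Q) ⟩
  (K * L) ^ Q * (X ^ Q * y ^ Q)      ≤⟨ *-monoʳ-≤ ((K * L) ^ Q) (*-mono-≤ X≤ y≤) ⟩
  (K * L) ^ Q * (R * (c ^ Q * S))    ≡⟨ regroup′ ((K * L) ^ Q) R (c ^ Q) S ⟩
  (K * L) ^ Q * c ^ Q * (R * S)      ≡⟨ cong (_* (R * S)) (^-distribʳ-* (K * L) c Q) ⟨
  (K * L * c) ^ Q * (R * S)          ∎
  where
  open ≤-Reasoning
  regroup : ∀ k l x y → k * (l * x * y) ≡ k * l * (x * y)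
  regroup = solve-∀
  regroup′ : ∀ a r c s → a * (r * (c * s)) ≡ a * c * (r * s)
  regroup′ = solve-∀

suc-^5 : ∀ z .{{_ : NonZero z}} → suc z ^ 5 ≤ 2 ^ 5 * z ^ 5
suc-^5 z = begin
  suc z ^ 5      ≤⟨ ^-monoˡ-≤ 5 (+-monoˡ-≤ z (>-nonZero⁻¹ z)) ⟩
  (z + z) ^ 5    ≡⟨ cong (λ k → (z + k) ^ 5) (+-identityʳ z) ⟨
  (2 * z) ^ 5    ≡⟨ ^-distribʳ-* 2 z 5 ⟩
  2 ^ 5 * z ^ 5  ∎
  where open ≤-Reasoning

-- By `power≤exponential` the left side is at most a constant times 2 ^ (3 + t); here 2 ^ 3 gives
-- the factor 8 and 2 ^ t is at most N ^ n. The constant is enlarged to a `Q`-th power to fit the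
-- common exponent.
log-power : ∀ Q n .{{_ : NonZero Q}} .{{_ : NonZero n}} {N t} .{{_ : NonZero N}} → 2 ^ t ≤ N →
            ((2 + suc t) ^ 2) ^ Q ≤ ((2 * Q) ^ (2 * Q) * 8) ^ Q * N ^ n
log-power Q n {N} {t} 2ᵗ≤N = begin
  ((2 + suc t) ^ 2) ^ Q  ≡⟨ ^-*-assoc (2 + suc t) 2 Q ⟩
  (3 + t) ^ (2 * Q)      ≤⟨ power≤exponential (2 * Q) {{2Q≢0}} (3 + t) ⟩
  c * 2 ^ (3 + t)        ≡⟨ cong (c *_) (^-distribˡ-+-* 2 3 t) ⟩
  c * (8 * 2 ^ t)        ≡⟨ *-assoc c 8 (2 ^ t) ⟨
  c * 8 * 2 ^ t          ≤⟨ *-mono-≤ (m≤m^n (c * 8) Q {{m*n≢0 c 8 {{c≢0}}}}) (≤-trans 2ᵗ≤N (m≤m^n N n)) ⟩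
  (c * 8) ^ Q * N ^ n    ∎
  where
  open ≤-Reasoning
  2Q≢0 : NonZero (2 * Q)
  2Q≢0 = m*n≢0 2 Q
  c : ℕ
  c = (2 * Q) ^ (2 * Q)
  c≢0 : NonZero c
  c≢0 = m^n≢0 (2 * Q) (2 * Q) {{2Q≢0}}

-- The factors come from `error-bound`, `suc-^5` and `log-power`, in this order.
constant : ℕ → ℕ
constant Q = 20 * 2 ^ 5 * ((2 * Q) ^ (2 * Q) * 8)

DeviationBound : (Q k n N m : ℕ) → Set
DeviationBound Q k n N m =
  ∣ m - (primeCount N + primeCountSqrt N) ∣ ^ Q ≤ constant Q ^ Q * N ^ (k + n)

-- The equation `5 * Q ≡ 12 * k` turns (z ^ 5) ^ Q into (z ^ 12) ^ k, at most N ^ k for z the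
-- integer twelfth root of N; the factor N ^ n pays for the logarithms.
deviation-bound : ∀ Q k n .{{_ : NonZero Q}} .{{_ : NonZero n}} → 5 * Q ≡ 12 * k →
                  ∀ N m → IsLargestDSPSize N m → DeviationBound Q k n N m
-- For `N` equal to 0 the right side is 0, so the deviation has to vanish; it does because `A` is
-- empty.
deviation-bound Q k n 5Q≡12k zero m ((A , _ , refl) , largest) =
  ≤-trans (≤-reflexive (trans (cong (_^ Q) no-deviation) (0^ Q))) z≤n
  where
  0^ : ∀ Q .{{_ : NonZero Q}} → 0 ^ Q ≡ 0
  0^ (suc _) = refl
  no-deviation : ∣ ∣ A ∣ - (primeCount 0 + primeCountSqrt 0) ∣ ≡ 0
  no-deviation = let B , dsp , π≤ = lower-bound 0 in
    trans (m≤n⇒∣n-m∣≡n∸m (≤-trans π≤ (largest B dsp)))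
          (n≤0⇒n≡0 (≤-trans (m∸n≤m ∣ A ∣ (primeCount 0 + primeCountSqrt 0)) (∣p∣≤n A)))
deviation-bound Q k n 5Q≡12k N@(suc _) m largest =
  let z , z¹²≤N , N<Z¹² = bracket (_^ 12) (λ k → ^-monoˡ-< 12 (n<1+n k)) N z≤n
      t , 2ᵗ≤N , N<2ᵗ⁺ = bracket (2 ^_) (λ k → ^-monoʳ-< 2 ≤-refl (n<1+n k)) N (s≤s z≤n)
  in ≤-trans (combine-bounds 20 (2 ^ 5) ((2 * Q) ^ (2 * Q) * 8)
                {x = suc z ^ 5} {z ^ 5} {(2 + suc t) ^ 2} {N ^ k} {N ^ n} Q
                (deviation {Z = suc z} {suc t} largest N<Z¹² N<2ᵗ⁺)
                (suc-^5 z {{z≢0 z N<Z¹²}}) (root-power z z¹²≤N) (log-power Q n {N} {t} 2ᵗ≤N))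
             (≤-reflexive (cong (constant Q ^ Q *_) (sym (^-distribˡ-+-* N k n))))
  where
  z≢0 : ∀ z → N < suc z ^ 12 → NonZero z
  z≢0 zero (s≤s ())
  z≢0 (suc _) _ = _
  root-power : ∀ z → z ^ 12 ≤ N → (z ^ 5) ^ Q ≤ N ^ k
  root-power z z¹²≤N = begin
    (z ^ 5) ^ Q     ≡⟨ ^-*-assoc z 5 Q ⟩
    z ^ (5 * Q)     ≡⟨ cong (z ^_) 5Q≡12k ⟩
    z ^ (12 * k)    ≡⟨ ^-*-assoc z 12 k ⟨
    (z ^ 12) ^ k    ≤⟨ ^-monoˡ-≤ k z¹²≤N ⟩
    N ^ k           ∎
    where open ≤-Reasoning

-- Raising to the power 12 (q + 1) keeps everything in the integers: this is the bound C N ^ (5/12 +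
-- ε) for ε = (p + 1) / (q + 1), and every positive rational ε has this form.
theorem1p3 : ∀ (p q : ℕ) → ∃ λ (C : ℕ) → ∀ (N m : ℕ) → IsLargestDSPSize N m →
    ∣ m - (primeCount N + primeCountSqrt N) ∣ ^ (12 * suc q)
    ≤ C ^ (12 * suc q) * N ^ (5 * suc q + 12 * suc p)
theorem1p3 p q = constant (12 * suc q) ,
  deviation-bound (12 * suc q) (5 * suc q) (12 * suc p)
    (x∙yz≈y∙xz *-commutativeSemigroup 5 12 (suc q))
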